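{- For every integer $n\geq 3$ there exists a word $u_1u_2\dots u_{n!}$ of length $n!$ over the alphabet $\{0,1,2,\dots,n\}$ such that each element of $S_n$ is order-isomorphic to exactly one of the $n!$ cyclic intervals $u_{i+1}u_{i+2}\dots u_{i+n}$ ($0\leq i\leq n!-1$) of length $n$ of the word.
   Context: $S_n$ is regarded as the set of all $n$-tuples $a_1a_2\dots a_n$ of distinct elements of $[n]=\{1,2,\dots,n\}$. Two $n$-tuples of distinct integers $a=a_1a_2\dots a_n$ and $b=b_1b_2\dots b_n$ are order-isomorphic if $a_i<a_j \Leftrightarrow b_i<b_j$ for all $1\leq i,j\leq n$. For a word $u_1u_2\dots u_N$ of length $N=n!$, the cyclic intervals of length $n$ are the $N$ words $u_{i+1}u_{i+2}\dots u_{i+n}$, one for each starting position $i\in\{0,1,\dots,N-1\}$, with index addition interpreted modulo $N$ (indices taken in $\{1,\dots,N\}$); intervals are counted by starting position. -}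

module Defs where

open import Data.Fin.Base using (Fin; toℕ)
open import Data.Fin.Properties using (nonZeroIndex)
open import Data.Nat.Base using (ℕ; _+_; _≤_; _<_; NonZero)
open import Data.Nat.DivMod using (_mod_)
open import Data.Product using (_×_)
open import Data.Vec.Functional using (Vector)
open import Function.Bundles using (_⇔_)
open import Function.Definitions using (Injective)
open import Relation.Binary.PropositionalEquality using (_≡_)

private
  variable
    n : ℕ

Distinct : Vector ℕ n → Set
Distinct a = Injective _≡_ _≡_ a

-- Membership in Sₙ, viewed as the set of n-tuples of distinct elements
-- of [n] = {1, …, n}.
IsPermutation : Vector ℕ n → Set
IsPermutation {n} a = (∀ i → 1 ≤ a i × a i ≤ n) × Distinct a

-- Order-isomorphism relates only tuples of distinct numbers, so an interval
-- with a repeated letter is order-isomorphic to nothing.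
OrderIsomorphic : Vector ℕ n → Vector ℕ n → Set
OrderIsomorphic a b =
  Distinct a × Distinct b × (∀ i j → (a i < a j) ⇔ (b i < b j))

-- Positions are 0-based: u k stands for the letter u_{k+1}, so this is
-- the word u_{i+1} u_{i+2} … u_{i+n}.
cyclicInterval : ∀ {N} → Vector ℕ N → (n : ℕ) → Fin N → Vector ℕ n
cyclicInterval {N} u n i j = u ((toℕ i + toℕ j) mod N)
  where instance
    N-nonZero : NonZero N
    N-nonZero = nonZeroIndex i

{-# OPTIONS --safe #-}
module Submission where

-- Each permutation w of the ranks 0, …, n−1 gets a label in {0, …, n}, constant on rotation classes:
-- the letter that is missing from the interval with the order type of w. Rotating an interval is a
-- closed walk of length n. If the letter words of v and w differ in a single place, where each has
-- the missing letter of the other, then after rotating that place to the front both words have the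
-- same successors, so the walks through v and w can be spliced. Hence a universal cycle exists as
-- soon as rotations and such moves connect all permutations.
--
-- For n = 3, 4, 5 suitable labels are given by tables. For n > 5 the label of w is that of w with its
-- maximum deleted, except on one rotation class, the hub, whose label is n. By induction from n = 5,
-- moves alone, without rotations, connect all words outside one rotation class, the leaf. Inserting
-- a new maximum at a fixed place preserves moves, and the hub has two neighbours whose maxima stand
-- in adjacent places, so the maximum can be brought to any place.

open import Defs
open import Data.Fin.Base using (Fin; toℕ; fromℕ<; zero; suc)
open import Data.Fin.Properties using (toℕ<n; toℕ-fromℕ<; toℕ-injective; fromℕ<-injective; injective⇒≤; any?)
open import Data.List.Base using (List; []; _∷_; [_]; _++_; _∷ʳ_; map; length; drop; take; filter; takeWhile; tabulate; downFrom; upTo; cartesianProduct)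
open import Data.List.Membership.Propositional using (_∈_; _∉_)
open import Data.List.Membership.Propositional.Properties using (∈-∃++; ∈-++⁺ˡ; ∈-++⁺ʳ; ∈-++⁻; ∈-map⁺; ∈-map⁻; ∈-cartesianProduct⁺; ∈-cartesianProduct⁻; ∈-upTo⁺; ∈-upTo⁻; ∈-downFrom⁺; ∈-downFrom⁻; ∈-tabulate⁺; ∈-tabulate⁻)
open import Data.List.Membership.Propositional.Properties.WithK using (unique∧set⇒bag)
import Data.List.Membership.DecPropositional as DecMembership
open import Data.List.Properties using (++-assoc; ++-identityʳ; length-++; length-map; length-take; length-drop; length-tabulate; length-upTo; length-downFrom; ∷-injective; take++drop≡id; take-map; drop-map; map-++; map-id-local; filter-++; filter-all; filter-accept; filter-reject; ≡-dec)
open import Data.List.Relation.Binary.BagAndSetEquality using (∼bag⇒↭)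
open import Data.List.Relation.Binary.Permutation.Propositional using (_↭_; ↭-refl; ↭-sym; ↭-trans; prep; ↭⇒↭ₛ)
open import Data.List.Relation.Binary.Permutation.Propositional.Properties using (↭-length; ∈-resp-↭; All-resp-↭; drop-mid; shift; ++-comm; ++⁺ˡ; ↭-empty-inv)
import Data.List.Relation.Binary.Permutation.Setoid.Properties as PermSetoid
open import Data.List.Relation.Unary.All as All using (All; []; _∷_; all?)
import Data.List.Relation.Unary.All.Properties as All
open import Data.List.Relation.Unary.AllPairs using ([]; _∷_)
open import Data.List.Relation.Unary.Any using (here; there)
open import Data.List.Relation.Unary.Unique.Propositional using (Unique)
import Data.List.Relation.Unary.Unique.Propositional.Properties as Unique
open import Data.Nat.Base
open import Data.Nat.DivMod using (_%_; _/_; _mod_; m%n<n; m<n⇒m%n≡m; m%n%n≡m%n; n%n≡0; m≡m%n+[m/n]*n; [m+kn]%n≡m%n)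
open import Data.Nat.Properties
open import Data.Product using (_×_; _,_; ∃; ∃₂; ∃!; proj₁; proj₂)
open import Data.Sum.Base using (_⊎_; inj₁; inj₂)
open import Data.Vec.Functional using (Vector)
open import Function.Base using (_∘_; id; case_of_)
open import Function.Bundles using (mk⇔; module Equivalence)
open import Function.Definitions using (Injective)
open import Relation.Binary.Construct.Closure.ReflexiveTransitive as Star using (Star; ε; _◅_; _◅◅_)
open import Relation.Binary.PropositionalEquality using (_≡_; _≢_; refl; sym; trans; cong; cong₂; subst; subst₂; setoid; module ≡-Reasoning)
open import Relation.Nullary using (Dec; yes; no; contradiction; ¬?)
open import Relation.Nullary.Decidable using (True; toWitness; from-yes; _×-dec_; _→-dec_)

private
  variable
    A B : Set
    n x : ℕ

-- Permutations of the ranks as words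

Unique-resp-↭ : {xs ys : List A} → xs ↭ ys → Unique xs → Unique ys
Unique-resp-↭ xs↭ys = PermSetoid.Unique-resp-↭ (setoid _) (↭⇒↭ₛ xs↭ys)

unique∧set⇒↭ : {xs ys : List A} → Unique xs → Unique ys →
               (∀ {x} → x ∈ xs → x ∈ ys) → (∀ {x} → x ∈ ys → x ∈ xs) → xs ↭ ys
unique∧set⇒↭ xs! ys! xs⊆ys ys⊆xs = ∼bag⇒↭ (unique∧set⇒bag xs! ys! (mk⇔ xs⊆ys ys⊆xs))

map-unique : {f : A → B} {P : A → Set} {xs : List A} →
             (∀ {x y} → P x → P y → f x ≡ f y → x ≡ y) → All P xs → Unique xs → Unique (map f xs)
map-unique inj []         []         = []
map-unique inj (px ∷ pxs) (x≢ ∷ xs!) =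
  All.map⁺ (All.zipWith (λ (py , x≢y) fx≡fy → x≢y (inj px py fx≡fy)) (pxs , x≢)) ∷ map-unique inj pxs xs!

Word : Set
Word = List ℕ

_≟ʷ_ : (v w : Word) → Dec (v ≡ w)
_≟ʷ_ = ≡-dec _≟_

open DecMembership _≟ʷ_ using (_∈?_)

-- Since `downFrom (suc n)` is `n ∷ downFrom n`, putting a new maximum in front is a single `prep`.
IsPerm : ℕ → Word → Set
IsPerm n w = w ↭ downFrom n

module _ {w : Word} (p : IsPerm n w) where

  perm-length : length w ≡ n
  perm-length = trans (↭-length p) (length-downFrom n)

  perm-< : x ∈ w → x < n
  perm-< = ∈-downFrom⁻ ∘ ∈-resp-↭ p

  perm-∈ : x < n → x ∈ w
  perm-∈ = ∈-resp-↭ (↭-sym p) ∘ ∈-downFrom⁺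

  perm-unique : Unique w
  perm-unique = Unique-resp-↭ (↭-sym p) (Unique.downFrom⁺ n)

  perm-n∉ : n ∉ w
  perm-n∉ n∈w = <-irrefl refl (perm-< n∈w)

perm-++-comm : ∀ xs {ys} → IsPerm n (xs ++ ys) → IsPerm n (ys ++ xs)
perm-++-comm xs {ys} p = ↭-trans (++-comm ys xs) p

insAt : ℕ → ℕ → Word → Word
insAt P m w = take P w ++ m ∷ drop P w

insAt-++ : ∀ xs m ys → insAt (length xs) m (xs ++ ys) ≡ xs ++ m ∷ ys
insAt-++ []       m ys = refl
insAt-++ (x ∷ xs) m ys = cong (x ∷_) (insAt-++ xs m ys)

insAt-perm : ∀ P {w} → IsPerm n w → IsPerm (suc n) (insAt P n w)
insAt-perm {n} P {w} p =
  ↭-trans (shift n (take P w) (drop P w)) (prep n (subst (_↭ downFrom n) (sym (take++drop≡id P w)) p))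

delete-max : ∀ xs {ys} → IsPerm (suc n) (xs ++ n ∷ ys) → IsPerm n (xs ++ ys)
delete-max xs p = drop-mid xs [] p

split-max : ∀ {w} → IsPerm (suc n) w → ∃₂ λ P v → IsPerm n v × P ≤ n × w ≡ insAt P n v
split-max {n} p with ∈-∃++ (perm-∈ p (n<1+n n))
... | xs , ys , refl =
  length xs , xs ++ ys , delete-max xs p , P≤n , sym (insAt-++ xs n ys)
  where
  P≤n : length xs ≤ n
  P≤n = subst (length xs ≤_) (trans (sym (length-++ xs)) (perm-length (delete-max xs p))) (m≤m+n _ _)

-- The place of `m` can be read off because `m` is new to both words. The bounds exclude places
-- behind the end, which would all give the same word.
insAt-injective : ∀ {P Q m v w} → m ∉ v → m ∉ w → P ≤ length v → Q ≤ length w →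
                  insAt P m v ≡ insAt Q m w → P ≡ Q × v ≡ w
insAt-injective {zero}  {zero}                        m∉v m∉w P≤ Q≤ eq = refl , proj₂ (∷-injective eq)
insAt-injective {zero}  {suc Q} {w = x ∷ w}           m∉v m∉w P≤ Q≤ eq = contradiction (here (proj₁ (∷-injective eq))) m∉w
insAt-injective {suc P} {zero}  {v = x ∷ v}           m∉v m∉w P≤ Q≤ eq = contradiction (here (sym (proj₁ (∷-injective eq)))) m∉v
insAt-injective {suc P} {suc Q} {v = x ∷ v} {w = y ∷ w} m∉v m∉w (s≤s P≤) (s≤s Q≤) eq
  with ∷-injective eq
... | refl , eq′ with insAt-injective (m∉v ∘ there) (m∉w ∘ there) P≤ Q≤ eq′
...   | refl , refl = refl , refl

length-cartesianProduct : ∀ (xs : List A) (ys : List B) → length (cartesianProduct xs ys) ≡ length xs * length ys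
length-cartesianProduct []       ys = refl
length-cartesianProduct (x ∷ xs) ys =
  trans (length-++ (map (x ,_) ys)) (cong₂ _+_ (length-map (x ,_) ys) (length-cartesianProduct xs ys))

perms : ℕ → List Word
perms zero    = [ [] ]
perms (suc n) = map (λ (P , w) → insAt P n w) (cartesianProduct (upTo (suc n)) (perms n))

perms-length : ∀ n → length (perms n) ≡ n !
perms-length zero    = refl
perms-length (suc n) = begin
  length (perms (suc n))                                ≡⟨ length-map _ (cartesianProduct (upTo (suc n)) (perms n)) ⟩
  length (cartesianProduct (upTo (suc n)) (perms n))    ≡⟨ length-cartesianProduct (upTo (suc n)) (perms n) ⟩
  length (upTo (suc n)) * length (perms n)              ≡⟨ cong₂ _*_ (length-upTo (suc n)) (perms-length n) ⟩
  suc n * n !                                           ∎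
  where open ≡-Reasoning

perms-sound : ∀ {w} → w ∈ perms n → IsPerm n w
perms-sound {zero}  (here refl) = ↭-refl
perms-sound {suc n} w∈ with ∈-map⁻ _ w∈
... | (P , v) , Pv∈ , refl = insAt-perm P (perms-sound (proj₂ (∈-cartesianProduct⁻ (upTo (suc n)) (perms n) Pv∈)))

perms-complete : ∀ {w} → IsPerm n w → w ∈ perms n
perms-complete {zero}  p rewrite ↭-empty-inv p = here refl
perms-complete {suc n} p with split-max p
... | P , v , pv , P≤n , refl = ∈-map⁺ _ (∈-cartesianProduct⁺ (∈-upTo⁺ (s≤s P≤n)) (perms-complete pv))

perms-unique : ∀ n → Unique (perms n)
perms-unique zero    = [] ∷ []
perms-unique (suc n) = map-unique
  (λ (P≤n , p) (Q≤n , q) eq →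
    let P≡Q , v≡w = insAt-injective (perm-n∉ p) (perm-n∉ q) (bound P≤n p) (bound Q≤n q) eq in cong₂ _,_ P≡Q v≡w)
  (All.tabulate λ Pw∈ →
    let P∈ , w∈ = ∈-cartesianProduct⁻ (upTo (suc n)) (perms n) Pw∈ in s≤s⁻¹ (∈-upTo⁻ P∈) , perms-sound w∈)
  (Unique.cartesianProduct⁺ (Unique.upTo⁺ (suc n)) (perms-unique n))
  where
  bound : ∀ {P w} → P ≤ n → IsPerm n w → P ≤ length w
  bound P≤n p = subst (_ ≤_) (sym (perm-length p)) P≤n

-- Letter words, closed walks and their splicing

-- up x enumerates ℕ ∖ {x} increasingly, so it turns ranks into letters when the letter x is missing.
up : ℕ → ℕ → ℕ
up zero    v       = suc v
up (suc x) zero    = zero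
up (suc x) (suc v) = suc (up x v)

rot : Word → Word
rot []       = []
rot (x ∷ xs) = xs ∷ʳ x

rot-++ : ∀ x xs ys → rot (x ∷ xs ++ ys) ≡ xs ++ (ys ∷ʳ x)
rot-++ x xs ys = ++-assoc xs ys [ x ]

rot-perm : ∀ {n} w → IsPerm n w → IsPerm n (rot w)
rot-perm []       p = p
rot-perm (x ∷ xs) p = perm-++-comm [ x ] p

-- Successive rotations of `xs ++ acc` until `xs` has passed to the back. The final `acc ++ xs` is
-- left out, as the list of a path leaves out its end point.
rots : Word → Word → List Word
rots []       acc = []
rots (x ∷ xs) acc = (x ∷ xs ++ acc) ∷ rots xs (acc ∷ʳ x)

first : Word → ℕ
first []      = 0
first (x ∷ _) = x

module UniversalCycle (n : ℕ) (ℓ : Word → ℕ) (ℓ-rot : ∀ w → IsPerm n w → ℓ (rot w) ≡ ℓ w) where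

  letters : Word → Word
  letters w = map (up (ℓ w)) w

  Step : Word → Word → Set
  Step v w = ∃ λ b → letters w ≡ drop 1 (letters v) ∷ʳ b

  SameTail : Word → Word → Set
  SameTail v w = drop 1 (letters v) ≡ drop 1 (letters w)

  same-tail-step : ∀ {p q v} → SameTail p q → Step p v → Step q v
  same-tail-step eq (b , e) = b , trans e (cong (_∷ʳ b) eq)

  rot-step : ∀ x xs → IsPerm n (x ∷ xs) → Step (x ∷ xs) (xs ∷ʳ x)
  rot-step x xs p = up (ℓ (x ∷ xs)) x ,
    trans (cong (λ l → map (up l) (xs ∷ʳ x)) (ℓ-rot (x ∷ xs) p)) (map-++ (up (ℓ (x ∷ xs))) xs [ x ])

  -- A walk along steps may switch between v and w of a cross edge, since both have the same successors.
  data Edge (v : Word) : Word → Set where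
    rotate : Edge v (rot v)
    cross  : ∀ {w} → IsPerm n w → SameTail v w → Edge v w

  infixr 5 _∷_
  -- `L` leaves out the end point, so concatenation of paths is `++` and a closed path does not list
  -- its start twice.
  data Path : Word → List Word → Word → Set where
    []  : ∀ {v} → Path v [] v
    _∷_ : ∀ {u v w L} → Step u v → Path v L w → Path u (u ∷ L) w

  _++ᵖ_ : ∀ {u v w L M} → Path u L v → Path v M w → Path u (L ++ M) w
  []      ++ᵖ q = q
  (s ∷ p) ++ᵖ q = s ∷ (p ++ᵖ q)

  split-path : ∀ {u w p L₂} L₁ → Path u (L₁ ++ p ∷ L₂) w → Path u L₁ p × ∃ λ v → Step p v × Path v L₂ w
  split-path []       (s ∷ ps) = [] , _ , s , ps
  split-path (_ ∷ L₁) (s ∷ ps) = let ps₁ , rest = split-path L₁ ps in s ∷ ps₁ , rest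

  rots-path : ∀ xs acc → IsPerm n (xs ++ acc) → Path (xs ++ acc) (rots xs acc) (acc ++ xs)
  rots-path []       acc p rewrite ++-identityʳ acc = []
  rots-path (x ∷ xs) acc p = subst (Step (x ∷ xs ++ acc)) (rot-++ x xs acc) (rot-step x (xs ++ acc) p)
    ∷ subst (Path _ _) (++-assoc acc [ x ] xs)
        (rots-path xs (acc ∷ʳ x) (subst (IsPerm n) (rot-++ x xs acc) (rot-perm _ p)))

  rots-perm : ∀ xs acc → IsPerm n (xs ++ acc) → All (IsPerm n) (rots xs acc)
  rots-perm []       acc p = []
  rots-perm (x ∷ xs) acc p = p ∷ rots-perm xs (acc ∷ʳ x) (subst (IsPerm n) (rot-++ x xs acc) (rot-perm _ p))

  rots-rot : ∀ xs acc {v} → v ∈ rots xs acc → rot v ∈ rots xs acc ⊎ rot v ≡ acc ++ xs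
  rots-rot (x ∷ [])     acc (here refl) = inj₂ refl
  rots-rot (x ∷ y ∷ xs) acc (here refl) = inj₁ (there (here (cong (y ∷_) (++-assoc xs acc [ x ]))))
  rots-rot (x ∷ xs)     acc (there v∈)  with rots-rot xs (acc ∷ʳ x) v∈
  ... | inj₁ r∈ = inj₁ (there r∈)
  ... | inj₂ eq = inj₂ (trans eq (++-assoc acc [ x ] xs))

  -- Rotations of a permutation are told apart by their first letters; this makes a necklace free of
  -- repetitions.
  rots-first : ∀ xs acc → map first (rots xs acc) ≡ xs
  rots-first []       acc = refl
  rots-first (x ∷ xs) acc = cong (x ∷_) (rots-first xs (acc ∷ʳ x))

  -- By `closed`, the vertex set is a union of rotation classes, so the class of a new word is
  -- disjoint from it.
  record Cycle (L : List Word) : Set where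
    field
      {start} : Word
      path    : Path start L start
      unique  : Unique L
      isPerms : All (IsPerm n) L
      closed  : ∀ {v} → v ∈ L → rot v ∈ L

  open Cycle

  closed-++-comm : ∀ {L} → (∀ {v} → v ∈ L → rot v ∈ L) → ∀ xs ys → xs ++ ys ∈ L → ys ++ xs ∈ L
  closed-++-comm {L} cl []       ys v∈ = subst (_∈ L) (sym (++-identityʳ ys)) v∈
  closed-++-comm {L} cl (x ∷ xs) ys v∈ = subst (_∈ L) (++-assoc ys [ x ] xs)
    (closed-++-comm cl xs (ys ∷ʳ x) (subst (_∈ L) (rot-++ x xs ys) (cl v∈)))

  -- Rotating on from `v` leads round to `acc ++ xs`. Hence a necklace with one word in `L` has its
  -- base word in `L`.
  rots-closed : ∀ {L} → (∀ {v} → v ∈ L → rot v ∈ L) → ∀ xs acc {v} → v ∈ rots xs acc → v ∈ L → acc ++ xs ∈ L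
  rots-closed cl (x ∷ xs) acc (here refl) v∈L = closed-++-comm cl (x ∷ xs) acc v∈L
  rots-closed cl (x ∷ xs) acc (there v∈)  v∈L =
    subst (_∈ _) (++-assoc acc [ x ] xs) (rots-closed cl xs (acc ∷ʳ x) v∈ v∈L)

  rots-unique : ∀ x xs → IsPerm n (x ∷ xs) → Unique ((x ∷ xs) ∷ rots xs [ x ])
  rots-unique x xs p = Unique.map⁻ (subst Unique (cong (x ∷_) (sym (rots-first xs [ x ]))) (perm-unique p))

  -- The list is `rots (x ∷ xs) []` with its first entry freed of a trailing `++ []`.
  necklace : ∀ x xs → IsPerm n (x ∷ xs) → Cycle ((x ∷ xs) ∷ rots xs [ x ])
  necklace x xs p = record
    { path    = rot-step x xs p ∷ rots-path xs [ x ] (rot-perm _ p)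
    ; unique  = rots-unique x xs p
    ; isPerms = p ∷ rots-perm xs [ x ] (rot-perm _ p)
    ; closed  = closed′
    }
    where
    rot-∈ : ∀ xs → rot (x ∷ xs) ∈ (x ∷ xs) ∷ rots xs [ x ]
    rot-∈ []      = here refl
    rot-∈ (_ ∷ _) = there (here refl)
    closed′ : ∀ {v} → v ∈ (x ∷ xs) ∷ rots xs [ x ] → rot v ∈ (x ∷ xs) ∷ rots xs [ x ]
    closed′ (here refl) = rot-∈ xs
    closed′ (there v∈) with rots-rot xs [ x ] v∈
    ... | inj₁ r∈ = there r∈
    ... | inj₂ eq = here eq

  -- Both cycles are cut behind p and q and reconnected crosswise.
  splice : ∀ {L p q} → Cycle L → p ∈ L → q ∉ L → IsPerm n q → SameTail p q →
           ∃ λ L′ → Cycle L′ × (∀ {v} → v ∈ L → v ∈ L′) × q ∈ L′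
  -- An empty `q` forces `p` to be empty as well, and then `q` would lie in `L`.
  splice {q = []} c p∈L q∉L pq t with All.lookup (isPerms c) p∈L
  splice {p = []} {q = []} c p∈L q∉L pq t | pp = contradiction p∈L q∉L
  splice {p = _ ∷ _} {q = []} c p∈L q∉L pq t | pp with trans (perm-length pp) (sym (perm-length pq))
  ... | ()
  splice {p = p} {q = x ∷ xs} c p∈L q∉L pq t with ∈-∃++ p∈L
  ... | L₁ , L₂ , refl = L′ , cycle′ , (λ v∈ → ∈-resp-↭ (↭-sym L′↭) (∈-++⁺ˡ v∈)) ,
      ∈-resp-↭ (↭-sym L′↭) (∈-++⁺ʳ L (here refl))
    where
    q = x ∷ xs
    N = rots xs [ x ]
    L = L₁ ++ p ∷ L₂
    L′ = L₁ ++ p ∷ (N ++ q ∷ L₂)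
    K = necklace x xs pq
    L′↭ : L′ ↭ L ++ (q ∷ N)
    L′↭ = ↭-trans
      (++⁺ˡ L₁ (prep p (↭-trans (shift q N L₂) (++-comm (q ∷ N) L₂))))
      (subst (L₁ ++ p ∷ (L₂ ++ q ∷ N) ↭_) (sym (++-assoc L₁ (p ∷ L₂) (q ∷ N))) ↭-refl)
    disjoint : ∀ {v} → v ∈ L × v ∈ q ∷ N → _
    disjoint (v∈L , here refl) = q∉L v∈L
    disjoint (v∈L , there v∈N) = q∉L (rots-closed (closed c) xs [ x ] v∈N v∈L)
    closed′ : ∀ {v} → v ∈ L′ → rot v ∈ L′
    closed′ v∈ with ∈-++⁻ L (∈-resp-↭ L′↭ v∈)
    ... | inj₁ v∈L = ∈-resp-↭ (↭-sym L′↭) (∈-++⁺ˡ (closed c v∈L))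
    ... | inj₂ v∈K = ∈-resp-↭ (↭-sym L′↭) (∈-++⁺ʳ L (closed K v∈K))
    path′ : Path (start c) L′ (start c)
    path′ with split-path L₁ (path c)
    ... | ps₁ , v , s , ps₂ = ps₁ ++ᵖ (same-tail-step {q} {p} (sym t) (rot-step x xs pq)
        ∷ (rots-path xs [ x ] (rot-perm _ pq) ++ᵖ (same-tail-step {p} {q} t s ∷ ps₂)))
    cycle′ : Cycle L′
    cycle′ = record
      { path    = path′
      ; unique  = Unique-resp-↭ (↭-sym L′↭) (Unique.++⁺ (unique c) (unique K) disjoint)
      ; isPerms = All-resp-↭ (↭-sym L′↭) (All.++⁺ (isPerms c) (isPerms K))
      ; closed  = closed′
      }

  extend : ∀ {L p q} → Cycle L → p ∈ L → Star Edge p q → ∃ λ L′ → Cycle L′ × (∀ {v} → v ∈ L → v ∈ L′) × q ∈ L′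
  extend c p∈L ε = _ , c , id , p∈L
  extend c p∈L (rotate ◅ es) = extend c (closed c p∈L) es
  extend {L} c p∈L (cross {q} pq t ◅ es) with q ∈? L
  ... | yes q∈L = extend c q∈L es
  ... | no  q∉L =
    let _ , c₁ , L⊆L₁ , q∈L₁ = splice c p∈L q∉L pq t
        _ , c₂ , L₁⊆L₂ , r∈L₂ = extend c₁ q∈L₁ es
    in _ , c₂ , L₁⊆L₂ ∘ L⊆L₁ , r∈L₂

  extend-all : ∀ {L p} qs → Cycle L → p ∈ L → All (Star Edge p) qs →
               ∃ λ L′ → Cycle L′ × (∀ {v} → v ∈ L → v ∈ L′) × All (_∈ L′) qs
  extend-all []       c p∈L []         = _ , c , id , []
  extend-all (q ∷ qs) c p∈L (es ∷ ess) =
    let _ , c₁ , L⊆L₁ , q∈L₁ = extend c p∈L es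
        _ , c₂ , L₁⊆L₂ , qs∈ = extend-all qs c₁ (L⊆L₁ p∈L) ess
    in _ , c₂ , L₁⊆L₂ ∘ L⊆L₁ , L₁⊆L₂ q∈L₁ ∷ qs∈

  hamiltonian : ∀ {x xs} → IsPerm n (x ∷ xs) → (∀ {w} → IsPerm n w → Star Edge (x ∷ xs) w) →
                ∃ λ L → Cycle L × L ↭ perms n
  hamiltonian {x} {xs} p conn =
    let L , c , _ , perms⊆L = extend-all (perms n) (necklace x xs p) (here refl) (All.tabulate (conn ∘ perms-sound))
    in L , c , unique∧set⇒↭ (unique c) (perms-unique n) (perms-complete ∘ All.lookup (isPerms c)) (All.lookup perms⊆L)

-- Reading the word off a Hamiltonian cycle

nth : {A : Set} → A → List A → ℕ → A
nth d []       _       = d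
nth d (x ∷ xs) zero    = x
nth d (x ∷ xs) (suc k) = nth d xs k

module _ {A : Set} (d : A) where

  nth-∈ : ∀ xs {k} → k < length xs → nth d xs k ∈ xs
  nth-∈ (x ∷ xs) {zero}  _         = here refl
  nth-∈ (x ∷ xs) {suc k} (s≤s k<) = there (nth-∈ xs k<)

  ∈⇒nth : ∀ {xs x} → x ∈ xs → ∃ λ k → k < length xs × nth d xs k ≡ x
  ∈⇒nth (here refl) = 0 , z<s , refl
  ∈⇒nth (there x∈)  = let k , k< , eq = ∈⇒nth x∈ in suc k , s<s k< , eq

  nth-injective : ∀ {xs} → Unique xs → ∀ {j k} → j < length xs → k < length xs → nth d xs j ≡ nth d xs k → j ≡ k
  nth-injective (x≢ ∷ xs!) {zero}  {zero}  _        _        eq = refl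
  nth-injective (x≢ ∷ xs!) {zero}  {suc k} _        (s≤s k<) eq = contradiction eq (All.lookup x≢ (nth-∈ _ k<))
  nth-injective (x≢ ∷ xs!) {suc j} {zero}  (s≤s j<) _        eq = contradiction (sym eq) (All.lookup x≢ (nth-∈ _ j<))
  nth-injective (x≢ ∷ xs!) {suc j} {suc k} (s≤s j<) (s≤s k<) eq = cong suc (nth-injective xs! j< k< eq)

  nth-++ˡ : ∀ xs {ys k} → k < length xs → nth d (xs ++ ys) k ≡ nth d xs k
  nth-++ˡ (x ∷ xs) {k = zero}  _        = refl
  nth-++ˡ (x ∷ xs) {k = suc k} (s≤s k<) = nth-++ˡ xs k<

  nth-ext : ∀ {xs ys} → length xs ≡ length ys → (∀ {k} → k < length xs → nth d xs k ≡ nth d ys k) → xs ≡ ys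
  nth-ext {[]}     {[]}     _  _  = refl
  nth-ext {x ∷ xs} {y ∷ ys} l≡ eq = cong₂ _∷_ (eq z<s) (nth-ext (suc-injective l≡) (eq ∘ s<s))

  nth-tabulate : ∀ {n} (f : Fin n → A) i → nth d (tabulate f) (toℕ i) ≡ f i
  nth-tabulate f zero    = refl
  nth-tabulate f (suc i) = nth-tabulate (f ∘ suc) i

nth-map : {A B : Set} (d : A) (e : B) (f : A → B) → ∀ xs {k} → k < length xs → nth e (map f xs) k ≡ f (nth d xs k)
nth-map d e f (x ∷ xs) {zero}  _        = refl
nth-map d e f (x ∷ xs) {suc k} (s≤s k<) = nth-map d e f xs k<

up-mono-< : ∀ x {v w} → v < w → up x v < up x w
up-mono-< zero    v<w                         = s<s v<w
up-mono-< (suc x) {zero}  {suc w} _           = z<s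
up-mono-< (suc x) {suc v} {suc w} (s≤s v<w) = s<s (up-mono-< x v<w)

up-cancel-< : ∀ x {v w} → up x v < up x w → v < w
up-cancel-< zero    (s≤s v<w)                 = v<w
up-cancel-< (suc x) {zero}  {suc w} _         = z<s
up-cancel-< (suc x) {suc v} {suc w} (s≤s v<w) = s<s (up-cancel-< x v<w)

up-injective : ∀ x {v w} → up x v ≡ up x w → v ≡ w
up-injective zero    eq                     = suc-injective eq
up-injective (suc x) {zero}  {zero}  eq     = refl
up-injective (suc x) {suc v} {suc w} eq     = cong suc (up-injective x (suc-injective eq))

up-≤ : ∀ x v → up x v ≤ suc v
up-≤ zero    v       = ≤-refl
up-≤ (suc x) zero    = z≤n
up-≤ (suc x) (suc v) = s≤s (up-≤ x v)

toℕ-mod : ∀ m N .{{_ : NonZero N}} → toℕ (m mod N) ≡ m % N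
toℕ-mod m N = toℕ-fromℕ< (m%n<n m N)

suc-% : ∀ k N .{{_ : NonZero N}} → (suc (k % N) < N × suc k % N ≡ suc (k % N)) ⊎ (suc (k % N) ≡ N × suc k % N ≡ 0)
suc-% k N with m≤n⇒m<n∨m≡n (m%n<n k N)
                | trans (cong (λ m → suc m % N) (m≡m%n+[m/n]*n k N)) ([m+kn]%n≡m%n (suc (k % N)) (k / N) N)
... | inj₁ lt | eq = inj₁ (lt , trans eq (m<n⇒m%n≡m lt))
... | inj₂ e  | eq = inj₂ (e , trans eq (trans (cong (_% N) e) (n%n≡0 N)))

-- Pigeonhole: a missed value could be put in front of `b`, injecting `suc n` places into `n`
-- values.
injective⇒onto : ∀ {n} {b : Vector ℕ n} → (∀ i → b i < n) → Injective _≡_ _≡_ b → ∀ {v} → v < n → ∃ λ i → b i ≡ v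
injective⇒onto {n} {b} b< b-inj {v} v<n with any? (λ i → b i ≟ v)
... | yes found = found
... | no  none  = contradiction (injective⇒≤ f-inj) 1+n≰n
  where
  f : Fin (suc n) → Fin n
  f zero    = fromℕ< v<n
  f (suc i) = fromℕ< (b< i)
  f-inj : Injective _≡_ _≡_ f
  f-inj {zero}  {zero}  eq = refl
  f-inj {zero}  {suc j} eq = contradiction (j , sym (fromℕ<-injective _ _ v<n (b< j) eq)) none
  f-inj {suc i} {zero}  eq = contradiction (i , fromℕ<-injective _ _ (b< i) v<n eq) none
  f-inj {suc i} {suc j} eq = cong suc (b-inj (fromℕ<-injective _ _ (b< i) (b< j) eq))

tabulate-perm : ∀ {n} {b : Vector ℕ n} → (∀ i → b i < n) → Injective _≡_ _≡_ b → IsPerm n (tabulate b)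
tabulate-perm {n} b< b-inj = unique∧set⇒↭ (Unique.tabulate⁺ b-inj) (Unique.downFrom⁺ n)
  (λ x∈ → let i , eq = ∈-tabulate⁻ x∈ in subst (_∈ downFrom n) (sym eq) (∈-downFrom⁺ (b< i)))
  (λ x∈ → let i , eq = injective⇒onto b< b-inj (∈-downFrom⁻ x∈) in subst (_∈ _) eq (∈-tabulate⁺ i))

-- By induction on v = b i: the predecessor of v is also a value of b.
monotone⇒≥ : ∀ {n} {b c : Vector ℕ n} → (∀ {v} → v < n → ∃ λ i → b i ≡ v) →
             (∀ {i j} → b i < b j → c i < c j) → ∀ v {i} → b i ≡ v → v < n → v ≤ c i
monotone⇒≥ onto mono zero    eq v<n = z≤n
monotone⇒≥ {b = b} onto mono (suc v) {i} eq v<n =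
  let j , eqⱼ = onto (<-trans (n<1+n v) v<n)
  in ≤-<-trans (monotone⇒≥ onto mono v eqⱼ (<-trans (n<1+n v) v<n))
               (mono (subst₂ _<_ (sym eqⱼ) (sym eq) (n<1+n v)))

UniversalCycleExists : ℕ → Set
UniversalCycleExists n = ∃ λ (u : Vector ℕ (n !)) → (∀ k → u k ≤ n) ×
  (∀ (a : Vector ℕ n) → IsPermutation a → ∃! _≡_ λ i → OrderIsomorphic a (cyclicInterval u n i))

module _ {n : ℕ} {ℓ : Word → ℕ} {ℓ-rot : ∀ w → IsPerm n w → ℓ (rot w) ≡ ℓ w} where
  open UniversalCycle n ℓ ℓ-rot
  open Cycle

  -- With the end point w as the default value of nth, the last step needs no case distinction.
  path-nth : ∀ {u L w k} → Path u L w → k < length L → Step (nth w L k) (nth w L (suc k))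
  path-nth {k = zero}  (s ∷ [])        _        = s
  path-nth {k = zero}  (s ∷ (s′ ∷ p))  _        = s
  path-nth {k = suc k} (s ∷ p)         (s≤s k<) = path-nth p k<

  path-nth-0 : ∀ {u L w} → Path u L w → nth w L 0 ≡ u
  path-nth-0 []      = refl
  path-nth-0 (_ ∷ _) = refl

  path-nth-length : ∀ {u L w} → Path u L w → nth w L (length L) ≡ w
  path-nth-length []      = refl
  path-nth-length (_ ∷ p) = path-nth-length p

  step-nth : ∀ {v w j} → length v ≡ n → suc j < n → Step v w → nth 0 (letters v) (suc j) ≡ nth 0 (letters w) j
  step-nth {x ∷ v} {w} {j} refl (s≤s j<) (b , eq) = trans (sym (nth-++ˡ 0 t j<′)) (cong (λ l → nth 0 l j) (sym eq))
    where
    t = map (up (ℓ (x ∷ v))) v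
    j<′ : j < length t
    j<′ = subst (j <_) (sym (length-map _ v)) j<

  module _ {L : List Word} (c : Cycle L) (L↭ : L ↭ perms n) where

    private instance
      n!≢0 : NonZero (n !)
      n!≢0 = n !≢0

    L-length : length L ≡ n !
    L-length = trans (↭-length L↭) (perms-length n)

    at : ℕ → Word
    at k = nth (start c) L (k % n !)

    at-< : ∀ k → k % n ! < length L
    at-< k = subst (k % n ! <_) (sym L-length) (m%n<n k (n !))

    at-perm : ∀ k → IsPerm n (at k)
    at-perm k = All.lookup (isPerms c) (nth-∈ _ L (at-< k))

    at-step : ∀ k → Step (at k) (at (suc k))
    at-step k = subst (Step (at k)) eq (path-nth (path c) (at-< k))
      where
      eq : nth (start c) L (suc (k % n !)) ≡ at (suc k)
      eq with suc-% k (n !)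
      ... | inj₁ (_ , e)   = cong (nth (start c) L) (sym e)
      -- At the wrap-around `nth` yields its default `start c`, which is also the first vertex.
      ... | inj₂ (e , e′) = begin
        nth (start c) L (suc (k % n !))  ≡⟨ cong (nth (start c) L) (trans e (sym L-length)) ⟩
        nth (start c) L (length L)       ≡⟨ path-nth-length (path c) ⟩
        start c                          ≡⟨ path-nth-0 (path c) ⟨
        nth (start c) L 0                ≡⟨ cong (nth (start c) L) e′ ⟨
        at (suc k)                       ∎
        where open ≡-Reasoning

    letter : ℕ → ℕ → ℕ
    letter k j = nth 0 (letters (at k)) j

    -- Consecutive letter words overlap in all but one letter, so the first letters of the vertices
    -- already determine every interval.
    letter-shift : ∀ k j → j < n → letter k j ≡ letter (k + j) 0
    letter-shift k zero    _   = cong (λ m → letter m 0) (sym (+-identityʳ k))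
    letter-shift k (suc j) j<n = begin
      letter k (suc j)      ≡⟨ step-nth {at k} (perm-length (at-perm k)) j<n (at-step k) ⟩
      letter (suc k) j      ≡⟨ letter-shift (suc k) j (<-trans (n<1+n j) j<n) ⟩
      letter (suc k + j) 0  ≡⟨ cong (λ m → letter m 0) (+-suc k j) ⟨
      letter (k + suc j) 0  ∎
      where open ≡-Reasoning

    letter-up : ∀ k (j : Fin n) → letter k (toℕ j) ≡ up (ℓ (at k)) (nth 0 (at k) (toℕ j))
    letter-up k j = nth-map 0 0 (up (ℓ (at k))) (at k) (subst (toℕ j <_) (sym (perm-length (at-perm k))) (toℕ<n j))

    universal : UniversalCycleExists n
    universal = u , u≤n , covered
      where
      u : Vector ℕ (n !)
      u k = letter (toℕ k) 0

      u≤n : ∀ k → u k ≤ n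
      u≤n k with at (toℕ k) | at-perm (toℕ k)
      ... | []    | _ = z≤n
      ... | x ∷ w | p = ≤-trans (up-≤ (ℓ (x ∷ w)) x) (perm-< p (here refl))

      interval : ∀ (i : Fin (n !)) (j : Fin n) → cyclicInterval u n i j ≡ up (ℓ (at (toℕ i))) (nth 0 (at (toℕ i)) (toℕ j))
      interval i j = begin
        cyclicInterval u n i j                    ≡⟨ cong (λ m → letter m 0) (toℕ-mod (toℕ i + toℕ j) (n !) ⦃ n!≢0 ⦄) ⟩
        letter ((toℕ i + toℕ j) % n !) 0
          -- The position is reduced twice, once by `cyclicInterval` and once by `at`.
          ≡⟨ cong (λ m → nth 0 (letters (nth (start c) L m)) 0) (m%n%n≡m%n (toℕ i + toℕ j) (n !)) ⟩
        letter (toℕ i + toℕ j) 0                  ≡⟨ letter-shift (toℕ i) (toℕ j) (toℕ<n j) ⟨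
        letter (toℕ i) (toℕ j)                    ≡⟨ letter-up (toℕ i) j ⟩
        up (ℓ (at (toℕ i))) (nth 0 (at (toℕ i)) (toℕ j)) ∎
        where open ≡-Reasoning

      covered : ∀ (a : Vector ℕ n) → IsPermutation a → ∃! _≡_ λ i → OrderIsomorphic a (cyclicInterval u n i)
      covered a (range , a-inj) = i₀ , iso₀ , λ {i} → only i
        where
        -- The tuple `a` has values from 1 to `n`, whereas ranks start at 0.
        b : Vector ℕ n
        b i = pred (a i)
        suc-b : ∀ i → suc (b i) ≡ a i
        suc-b i = suc-pred (a i) ⦃ >-nonZero (proj₁ (range i)) ⦄
        b< : ∀ i → b i < n
        b< i = subst (_≤ n) (sym (suc-b i)) (proj₂ (range i))
        b-inj : Injective _≡_ _≡_ b
        b-inj {i} {j} eq = a-inj (trans (sym (suc-b i)) (trans (cong suc eq) (suc-b j)))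
        b⇒a : ∀ {i j} → b i < b j → a i < a j
        b⇒a lt = subst₂ _<_ (suc-b _) (suc-b _) (s<s lt)
        a⇒b : ∀ {i j} → a i < a j → b i < b j
        a⇒b lt = s<s⁻¹ (subst₂ _<_ (sym (suc-b _)) (sym (suc-b _)) lt)

        w : Word
        w = tabulate b

        found : ∃ λ k → k < length L × nth (start c) L k ≡ w
        found = ∈⇒nth _ (∈-resp-↭ (↭-sym L↭) (perms-complete (tabulate-perm b< b-inj)))

        k<n! : proj₁ found < n !
        k<n! = subst (proj₁ found <_) L-length (proj₁ (proj₂ found))

        i₀ : Fin (n !)
        i₀ = fromℕ< k<n!

        at-toℕ : ∀ (i : Fin (n !)) → at (toℕ i) ≡ nth (start c) L (toℕ i)
        at-toℕ i = cong (nth (start c) L) (m<n⇒m%n≡m (toℕ<n i))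

        at-i₀ : at (toℕ i₀) ≡ w
        at-i₀ = trans (at-toℕ i₀) (trans (cong (nth (start c) L) (toℕ-fromℕ< k<n!)) (proj₂ (proj₂ found)))

        interval₀ : ∀ j → cyclicInterval u n i₀ j ≡ up (ℓ w) (b j)
        interval₀ j = trans (interval i₀ j)
          (trans (cong (λ v → up (ℓ v) (nth 0 v (toℕ j))) at-i₀) (cong (up (ℓ w)) (nth-tabulate 0 b j)))

        iso₀ : OrderIsomorphic a (cyclicInterval u n i₀)
        iso₀ = a-inj
          , (λ {i} {j} eq → b-inj (up-injective (ℓ w) (trans (sym (interval₀ i)) (trans eq (interval₀ j)))))
          , λ i j → mk⇔
              (λ lt → subst₂ _<_ (sym (interval₀ i)) (sym (interval₀ j)) (up-mono-< (ℓ w) (a⇒b lt)))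
              (λ lt → b⇒a (up-cancel-< (ℓ w) (subst₂ _<_ (interval₀ i) (interval₀ j) lt)))

        only : ∀ i → OrderIsomorphic a (cyclicInterval u n i) → i₀ ≡ i
        only i (_ , _ , iso) = toℕ-injective (nth-injective (start c) (unique c) (<L i₀) (<L i) (begin
            nth (start c) L (toℕ i₀)  ≡⟨ at-toℕ i₀ ⟨
            at (toℕ i₀)               ≡⟨ at-i₀ ⟩
            w                         ≡⟨ w≡v ⟩
            v                         ≡⟨ at-toℕ i ⟩
            nth (start c) L (toℕ i)   ∎))
          where
          open ≡-Reasoning
          <L : ∀ (i : Fin (n !)) → toℕ i < length L
          <L i = subst (toℕ i <_) (sym L-length) (toℕ<n i)
          v = at (toℕ i)
          v-perm = at-perm (toℕ i)
          d : Vector ℕ n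
          d j = nth 0 v (toℕ j)
          d-onto : ∀ {y} → y < n → ∃ λ j → d j ≡ y
          d-onto y<n =
            let k , k< , eq = ∈⇒nth 0 (perm-∈ v-perm y<n)
                k<n = subst (k <_) (perm-length v-perm) k<
            in fromℕ< k<n , trans (cong (nth 0 v) (toℕ-fromℕ< k<n)) eq
          d< : ∀ j → d j < n
          d< j = perm-< v-perm (nth-∈ 0 v (subst (toℕ j <_) (sym (perm-length v-perm)) (toℕ<n j)))
          b⇒d : ∀ {j k} → b j < b k → d j < d k
          b⇒d {j} {k} lt = up-cancel-< (ℓ v) (subst₂ _<_ (interval i j) (interval i k) (Equivalence.to (iso j k) (b⇒a lt)))
          d⇒b : ∀ {j k} → d j < d k → b j < b k
          d⇒b {j} {k} lt = a⇒b (Equivalence.from (iso j k)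
            (subst₂ _<_ (sym (interval i j)) (sym (interval i k)) (up-mono-< (ℓ v) lt)))
          b≡d : ∀ j → b j ≡ d j
          -- Both tuples take all values below `n`, and they are ordered alike, so each bounds the
          -- other from below.
          b≡d j = ≤-antisym (monotone⇒≥ (injective⇒onto b< b-inj) b⇒d _ refl (b< j)) (monotone⇒≥ d-onto d⇒b _ refl (d< j))
          w≡v : w ≡ v
          w≡v = nth-ext 0 (trans (length-tabulate b) (sym (perm-length v-perm))) λ {k} k< →
            let k<n = subst (k <_) (length-tabulate b) k<
                j = fromℕ< k<n
            in begin
              nth 0 w k        ≡⟨ cong (nth 0 w) (toℕ-fromℕ< k<n) ⟨
              nth 0 w (toℕ j)  ≡⟨ nth-tabulate 0 b j ⟩
              b j              ≡⟨ b≡d j ⟩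
              d j              ≡⟨ cong (nth 0 v) (toℕ-fromℕ< k<n) ⟩
              nth 0 v k        ∎

-- Rotation classes and their normal forms

infix 4 _⟲_
data _⟲_ : Word → Word → Set where
  done : ∀ {w} → w ⟲ w
  turn : ∀ {v w} → rot v ⟲ w → v ⟲ w

⟲-trans : ∀ {u v w} → u ⟲ v → v ⟲ w → u ⟲ w
⟲-trans done     q = q
⟲-trans (turn p) q = turn (⟲-trans p q)

⟲-++ : ∀ xs ys → xs ++ ys ⟲ ys ++ xs
⟲-++ []       ys = subst (ys ⟲_) (sym (++-identityʳ ys)) done
⟲-++ (x ∷ xs) ys = turn (subst₂ _⟲_ (sym (rot-++ x xs ys)) (++-assoc ys [ x ] xs) (⟲-++ xs (ys ∷ʳ x)))

⟲-perm : ∀ {v w} → v ⟲ w → IsPerm n v → IsPerm n w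
⟲-perm done             p = p
⟲-perm {v = v} (turn r) p = ⟲-perm r (rot-perm v p)

normFrom : Word → Word → Word
normFrom acc []           = acc
normFrom acc (zero  ∷ ys) = zero ∷ ys ++ acc
normFrom acc (suc x ∷ ys) = normFrom (acc ∷ʳ suc x) ys

-- The rotation starting with 0 represents the class. The letter 0 survives the deletion of a
-- maximum, so `norm` commutes with that deletion.
norm : Word → Word
norm = normFrom []

normFrom-++ : ∀ acc as bs → 0 ∉ as → normFrom acc (as ++ 0 ∷ bs) ≡ 0 ∷ bs ++ (acc ++ as)
normFrom-++ acc []           bs 0∉ = cong (λ l → 0 ∷ bs ++ l) (sym (++-identityʳ acc))
normFrom-++ acc (zero  ∷ as) bs 0∉ = contradiction (here refl) 0∉
normFrom-++ acc (suc a ∷ as) bs 0∉ =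
  trans (normFrom-++ (acc ∷ʳ suc a) as bs (0∉ ∘ there)) (cong (λ l → 0 ∷ bs ++ l) (++-assoc acc [ suc a ] as))

norm-++ : ∀ as bs → 0 ∉ as → norm (as ++ 0 ∷ bs) ≡ 0 ∷ bs ++ as
norm-++ = normFrom-++ []

split-zero : ∀ {w} → IsPerm (suc n) w → ∃₂ λ as bs → w ≡ as ++ 0 ∷ bs × 0 ∉ as × 0 ∉ bs
split-zero p with ∈-∃++ (perm-∈ p z<s)
... | as , bs , refl = as , bs , refl , 0∉ ∘ ∈-++⁺ˡ , 0∉ ∘ ∈-++⁺ʳ as
  where
  0∉ : 0 ∉ as ++ bs
  0∉ = Unique.Unique[x∷xs]⇒x∉xs (Unique-resp-↭ (shift 0 as bs) (perm-unique p))

norm-rot : ∀ w → IsPerm (suc n) w → norm (rot w) ≡ norm w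
norm-rot w p with split-zero p
... | [] , bs , refl , _ , 0∉bs = trans (norm-++ bs [] 0∉bs) (cong (0 ∷_) (sym (++-identityʳ bs)))
... | a ∷ as , bs , refl , 0∉as , _ = begin
  norm ((as ++ 0 ∷ bs) ∷ʳ a)  ≡⟨ cong norm (++-assoc as (0 ∷ bs) [ a ]) ⟩
  norm (as ++ 0 ∷ (bs ∷ʳ a))  ≡⟨ norm-++ as (bs ∷ʳ a) (0∉as ∘ there) ⟩
  0 ∷ (bs ∷ʳ a) ++ as         ≡⟨ cong (0 ∷_) (++-assoc bs [ a ] as) ⟩
  0 ∷ bs ++ a ∷ as            ≡⟨ norm-++ (a ∷ as) bs 0∉as ⟨
  norm (a ∷ as ++ 0 ∷ bs)     ∎
  where open ≡-Reasoning

⟲-norm : ∀ {v w} → v ⟲ w → IsPerm (suc n) v → norm v ≡ norm w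
⟲-norm done             p = refl
⟲-norm {v = v} (turn r) p = trans (sym (norm-rot v p)) (⟲-norm r (rot-perm v p))

-- Rotate `v` to the common normal form and from there on to `w`.
norm-⟲ : ∀ {v w} → IsPerm (suc n) v → IsPerm (suc n) w → norm v ≡ norm w → v ⟲ w
norm-⟲ p q eq with split-zero p | split-zero q
... | as , bs , refl , 0∉as , _ | cs , ds , refl , 0∉cs , _ =
  ⟲-trans (⟲-++ as (0 ∷ bs))
    (subst (_⟲ cs ++ 0 ∷ ds) (trans (sym (norm-++ cs ds 0∉cs)) (trans (sym eq) (norm-++ as bs 0∉as))) (⟲-++ (0 ∷ ds) cs))

-- Moves between rotation classes

module Labelled (k : ℕ) (f : Word → ℕ) where

  ℓ : Word → ℕ
  ℓ w = f (norm w)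

  open UniversalCycle (suc k) ℓ (λ w p → cong f (norm-rot w p)) public

  -- In contrast to `SameTail`, the differing place is arbitrary. Hence moves can survive the
  -- insertion of a maximum at any fixed place.
  Move : Word → Word → Set
  Move v w = ∃₂ λ as bs → letters v ≡ as ++ ℓ w ∷ bs × letters w ≡ as ++ ℓ v ∷ bs

  move-sym : ∀ {v w} → Move v w → Move w v
  move-sym (as , bs , v≡ , w≡) = as , bs , w≡ , v≡

  letters-rot : ∀ {w} → IsPerm (suc k) w → letters (rot w) ≡ rot (letters w)
  letters-rot {[]}    p = refl
  letters-rot {x ∷ w} p = proj₂ (rot-step x w p)

  move-rot : ∀ {v w} → IsPerm (suc k) v → IsPerm (suc k) w → Move v w → Move (rot v) (rot w)
  move-rot {v} {w} p q (as , bs , v≡ , w≡) = shifted as v≡ w≡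
    where
    rotated : ∀ {u l} → IsPerm (suc k) u → letters u ≡ l → letters (rot u) ≡ rot l
    rotated r eq = trans (letters-rot r) (cong rot eq)
    ℓv : ℓ (rot v) ≡ ℓ v
    ℓv = cong f (norm-rot v p)
    ℓw : ℓ (rot w) ≡ ℓ w
    ℓw = cong f (norm-rot w q)
    shifted : ∀ as → letters v ≡ as ++ ℓ w ∷ bs → letters w ≡ as ++ ℓ v ∷ bs → Move (rot v) (rot w)
    shifted []       v≡ w≡ = bs , [] ,
      trans (rotated p v≡) (cong (bs ∷ʳ_) (sym ℓw)) , trans (rotated q w≡) (cong (bs ∷ʳ_) (sym ℓv))
    shifted (a ∷ as) v≡ w≡ = as , bs ∷ʳ a ,
      trans (rotated p v≡) (trans (++-assoc as (ℓ w ∷ bs) [ a ]) (cong (λ y → as ++ y ∷ bs ∷ʳ a) (sym ℓw))) ,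
      trans (rotated q w≡) (trans (++-assoc as (ℓ v ∷ bs) [ a ]) (cong (λ y → as ++ y ∷ bs ∷ʳ a) (sym ℓv)))

  move-⟲ : ∀ {v v′ w} → IsPerm (suc k) v → IsPerm (suc k) w → Move v w → v ⟲ v′ → ∃ λ w′ → w ⟲ w′ × Move v′ w′
  move-⟲ p q m done = _ , done , m
  move-⟲ p q m (turn r) =
    let w′ , s , m′ = move-⟲ (rot-perm _ p) (rot-perm _ q) (move-rot p q m) r in w′ , turn s , m′

  -- `move-⟲` yields some rotation of the second word; here both words turn by the same known number
  -- of places.
  move-++ : ∀ {xs ys xs′ ys′} → length xs ≡ length xs′ → IsPerm (suc k) (xs ++ ys) → IsPerm (suc k) (xs′ ++ ys′) →
            Move (xs ++ ys) (xs′ ++ ys′) → Move (ys ++ xs) (ys′ ++ xs′)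
  move-++ {[]}     {ys} {[]}       {ys′} eq p q m = subst₂ Move (sym (++-identityʳ ys)) (sym (++-identityʳ ys′)) m
  move-++ {x ∷ xs} {ys} {x′ ∷ xs′} {ys′} eq p q m =
    subst₂ Move (++-assoc ys [ x ] xs) (++-assoc ys′ [ x′ ] xs′)
      (move-++ {xs} {ys ∷ʳ x} {xs′} {ys′ ∷ʳ x′} (suc-injective eq)
        (subst (IsPerm _) (rot-++ x xs ys) (rot-perm _ p)) (subst (IsPerm _) (rot-++ x′ xs′ ys′) (rot-perm _ q))
        (subst₂ Move (rot-++ x xs ys) (rot-++ x′ xs′ ys′) (move-rot p q m)))

  ⟲-edges : ∀ {v w} → v ⟲ w → Star Edge v w
  ⟲-edges done     = ε
  ⟲-edges (turn r) = rotate ◅ ⟲-edges r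

  unrotate : ∀ w → rot w ⟲ w
  unrotate []      = done
  unrotate (x ∷ w) = ⟲-++ w [ x ]

  -- Recursion on the number of letters before the differing place: each is rotated to the back, the
  -- front place is crossed, and `w` is turned back.
  move-edges : ∀ {v w} → IsPerm (suc k) v → IsPerm (suc k) w → Move v w → Star Edge v w
  move-edges {v} {w} p q m@(as , _) = go (length as) p q m refl
    where
    go : ∀ j {v w} → IsPerm (suc k) v → IsPerm (suc k) w → (m : Move v w) → j ≡ length (proj₁ m) → Star Edge v w
    go zero    {v} {w} p q ([] , bs , v≡ , w≡) _  = cross q (trans (cong (drop 1) v≡) (sym (cong (drop 1) w≡))) ◅ ε
    go (suc j) {v} {w} p q m@(a ∷ as , bs , v≡ , w≡) eq =
      rotate ◅ (go j (rot-perm v p) (rot-perm w q) (move-rot p q m) (suc-injective eq) ◅◅ ⟲-edges (unrotate w))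

  -- A single rotation is undone by rotating the rest of the way round.
  edges-sym : ∀ {v w} → IsPerm (suc k) v → Star Edge v w → Star Edge w v
  edges-sym p ε                   = ε
  edges-sym p (rotate    ◅ es) = edges-sym (rot-perm _ p) es ◅◅ ⟲-edges (unrotate _)
  edges-sym p (cross q t ◅ es) = edges-sym q es ◅◅ (cross p (sym t) ◅ ε)

  norm-⟲-self : ∀ {w} → IsPerm (suc k) w → w ⟲ norm w
  norm-⟲-self p with split-zero p
  ... | as , bs , refl , 0∉as , _ = subst (as ++ 0 ∷ bs ⟲_) (sym (norm-++ as bs 0∉as)) (⟲-++ as (0 ∷ bs))

-- Labels and moves given by tables

decide-perm : ∀ n w {w∈? : True (w ∈? perms n)} → IsPerm n w
decide-perm n w {w∈?} = perms-sound (toWitness w∈?)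

-- A row (v , ℓ , y) gives the label ℓ of the normalised word v and the letter y which the next move
-- on the way to a root replaces by ℓ.
Table : Set
Table = List (Word × ℕ × ℕ)

lookupRow : Table → Word → ℕ × ℕ
lookupRow []                v = 0 , 0
lookupRow ((w , row) ∷ t) v with v ≟ʷ w
... | yes _ = row
... | no  _ = lookupRow t v

label target : Table → Word → ℕ
label  t v = proj₁ (lookupRow t v)
target t v = proj₂ (lookupRow t v)

label-≤ : ∀ {b} t → All (λ r → proj₁ (proj₂ r) ≤ b) t → ∀ v → label t v ≤ b
label-≤ []            []       v = z≤n
label-≤ ((w , _) ∷ t) (p ∷ ps) v with v ≟ʷ w
... | yes _ = p
... | no  _ = label-≤ t ps v

-- Inverse of `up x` on letters other than `x`.
down : ℕ → ℕ → ℕ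
down zero    v       = pred v
down (suc x) zero    = zero
down (suc x) (suc v) = suc (down x v)

replace : ℕ → ℕ → ℕ → ℕ
replace y x v with v ≟ y
... | yes _ = x
... | no  _ = v

module Check (k : ℕ) (t : Table) where
  open Labelled k (label t) public

  -- Once `ℓ w` stands in place of `y`, the missing letter is `y`, so `down y` gives the ranks.
  next : Word → Word
  next w = map (down y) (map (replace y (ℓ w)) (letters w))
    where y = target t (norm w)

  -- The context of the exchanged letter is computed from the place of `y`, which makes the
  -- existential statement of a move decidable.
  Valid : Word → Set
  Valid w = next w ∈ perms (suc k) × letters w ≡ as ++ ℓ (next w) ∷ bs × letters (next w) ≡ as ++ ℓ w ∷ bs
    where
    y  = target t (norm w)
    as = takeWhile (λ x → ¬? (x ≟ y)) (letters w)
    bs = drop (suc (length as)) (letters w)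

  valid? : ∀ w → Dec (Valid w)
  valid? w = (_ ∈? _) ×-dec (_ ≟ʷ _) ×-dec (_ ≟ʷ _)

  valid⇒move : ∀ {w} → Valid w → Move w (next w)
  valid⇒move (_ , v≡ , w≡) = _ , _ , v≡ , w≡

-- The leaf, the hub and the table for length 5

desc : ℕ → Word
desc zero    = []
desc (suc m) = 5 + m ∷ desc m

-- Both leaf (suc m) and hub m have length 6 + m and become leaf m when their maximum is deleted.
leaf hub : ℕ → Word
leaf m = 0 ∷ 1 ∷ 2 ∷ 4 ∷ 3 ∷ desc m
hub m  = 0 ∷ 5 + m ∷ 1 ∷ 2 ∷ 4 ∷ 3 ∷ desc m

-- Found by computer search. The targets form a spanning tree of the rotation classes other than the
-- leaf, except that the target of the root closes a cycle around which words come back rotated;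
-- hence all rotations of the root are connected as well.
table₅ : Table
table₅ =
  (0 ∷ 1 ∷ 2 ∷ 3 ∷ 4 ∷ [] , 4 , 2) ∷
  (0 ∷ 1 ∷ 2 ∷ 4 ∷ 3 ∷ [] , 1 , 3) ∷
  (0 ∷ 1 ∷ 3 ∷ 2 ∷ 4 ∷ [] , 2 , 5) ∷
  (0 ∷ 1 ∷ 3 ∷ 4 ∷ 2 ∷ [] , 3 , 5) ∷
  (0 ∷ 1 ∷ 4 ∷ 2 ∷ 3 ∷ [] , 1 , 4) ∷
  (0 ∷ 1 ∷ 4 ∷ 3 ∷ 2 ∷ [] , 5 , 0) ∷
  (0 ∷ 2 ∷ 1 ∷ 3 ∷ 4 ∷ [] , 5 , 1) ∷
  (0 ∷ 2 ∷ 1 ∷ 4 ∷ 3 ∷ [] , 3 , 5) ∷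
  (0 ∷ 2 ∷ 3 ∷ 1 ∷ 4 ∷ [] , 5 , 3) ∷
  (0 ∷ 2 ∷ 3 ∷ 4 ∷ 1 ∷ [] , 1 , 3) ∷
  (0 ∷ 2 ∷ 4 ∷ 1 ∷ 3 ∷ [] , 3 , 1) ∷
  (0 ∷ 2 ∷ 4 ∷ 3 ∷ 1 ∷ [] , 4 , 0) ∷
  (0 ∷ 3 ∷ 1 ∷ 2 ∷ 4 ∷ [] , 1 , 4) ∷
  (0 ∷ 3 ∷ 1 ∷ 4 ∷ 2 ∷ [] , 0 , 2) ∷
  (0 ∷ 3 ∷ 2 ∷ 1 ∷ 4 ∷ [] , 0 , 3) ∷
  (0 ∷ 3 ∷ 2 ∷ 4 ∷ 1 ∷ [] , 0 , 2) ∷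
  (0 ∷ 3 ∷ 4 ∷ 1 ∷ 2 ∷ [] , 0 , 5) ∷
  (0 ∷ 3 ∷ 4 ∷ 2 ∷ 1 ∷ [] , 4 , 0) ∷
  (0 ∷ 4 ∷ 1 ∷ 2 ∷ 3 ∷ [] , 4 , 2) ∷
  (0 ∷ 4 ∷ 1 ∷ 3 ∷ 2 ∷ [] , 2 , 0) ∷
  (0 ∷ 4 ∷ 2 ∷ 1 ∷ 3 ∷ [] , 2 , 5) ∷
  (0 ∷ 4 ∷ 2 ∷ 3 ∷ 1 ∷ [] , 5 , 1) ∷
  (0 ∷ 4 ∷ 3 ∷ 1 ∷ 2 ∷ [] , 1 , 4) ∷
  (0 ∷ 4 ∷ 3 ∷ 2 ∷ 1 ∷ [] , 3 , 1) ∷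
  []

root₅ : Word
root₅ = 0 ∷ 1 ∷ 4 ∷ 2 ∷ 3 ∷ []

module C₅ = Check 4 table₅

follow : (Word → Word) → Word → ℕ → Word → Word
follow nx r zero    w = w
follow nx r (suc j) w with w ≟ʷ r
... | yes _ = w
... | no  _ = follow nx r j (nx w)

-- The first half includes the leaf class, whose words thereby get a move out of it, and ensures
-- that no chosen move enters it. In the second half 31 moves suffice for every word, without any
-- rotation.
Checked₅ : Word → Set
Checked₅ w = (C₅.Valid w × norm (C₅.next w) ≢ leaf 0) × (norm w ≢ leaf 0 → follow C₅.next root₅ 31 w ≡ root₅)

checked₅? : ∀ w → Dec (Checked₅ w)
checked₅? w = (C₅.valid? w ×-dec ¬? (norm (C₅.next w) ≟ʷ leaf 0))
  ×-dec (¬? (norm w ≟ʷ leaf 0) →-dec (follow C₅.next root₅ 31 w ≟ʷ root₅))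

checked₅ : All Checked₅ (perms 5)
checked₅ = from-yes (all? checked₅? (perms 5))

-- Deleting and inserting the maximum

≢? : ∀ m (x : ℕ) → Dec (x ≢ m)
≢? m x = ¬? (x ≟ m)

del : ℕ → Word → Word
del m = filter (≢? m)

del-∉ : ∀ {m w} → m ∉ w → del m w ≡ w
del-∉ {m} m∉w = filter-all (≢? m) (All.tabulate λ x∈w x≡m → m∉w (subst (_∈ _) x≡m x∈w))

del-here : ∀ m w → del m (m ∷ w) ≡ del m w
del-here m w = filter-reject (≢? m) (λ m≢m → m≢m refl)

del-there : ∀ {m x} w → x ≢ m → del m (x ∷ w) ≡ x ∷ del m w
del-there {m} w x≢m = filter-accept (≢? m) x≢m

del-insAt : ∀ P {m w} → m ∉ w → del m (insAt P m w) ≡ w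
del-insAt P {m} {w} m∉w = begin
  del m (take P w ++ m ∷ drop P w)         ≡⟨ filter-++ (≢? m) (take P w) (m ∷ drop P w) ⟩
  del m (take P w) ++ del m (m ∷ drop P w) ≡⟨ cong (del m (take P w) ++_) (del-here m (drop P w)) ⟩
  del m (take P w) ++ del m (drop P w)     ≡⟨ filter-++ (≢? m) (take P w) (drop P w) ⟨
  del m (take P w ++ drop P w)             ≡⟨ cong (del m) (take++drop≡id P w) ⟩
  del m w                                  ≡⟨ del-∉ m∉w ⟩
  w                                        ∎
  where open ≡-Reasoning

-- The deleted letter is not 0, so the place where the word is cut stays the same.
normFrom-del : ∀ m acc w → normFrom (del (suc m) acc) (del (suc m) w) ≡ del (suc m) (normFrom acc w)
normFrom-del m acc []          = refl
normFrom-del m acc (zero  ∷ w) = cong (0 ∷_) (sym (filter-++ (≢? (suc m)) w acc))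
normFrom-del m acc (suc x ∷ w) with suc x ≟ suc m
... | yes refl = begin
  normFrom (del (suc m) acc) (del (suc m) (suc m ∷ w))  ≡⟨ cong (normFrom (del (suc m) acc)) (del-here (suc m) w) ⟩
  normFrom (del (suc m) acc) (del (suc m) w)            ≡⟨ cong (λ l → normFrom l (del (suc m) w)) acc≡ ⟨
  normFrom (del (suc m) (acc ∷ʳ suc m)) (del (suc m) w) ≡⟨ normFrom-del m (acc ∷ʳ suc m) w ⟩
  del (suc m) (normFrom (acc ∷ʳ suc m) w)               ∎
  where
  open ≡-Reasoning
  acc≡ : del (suc m) (acc ∷ʳ suc m) ≡ del (suc m) acc
  acc≡ = trans (filter-++ (≢? (suc m)) acc _) (trans (cong (del (suc m) acc ++_) (del-here (suc m) [])) (++-identityʳ _))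
... | no x≢m = begin
  normFrom (del (suc m) acc) (del (suc m) (suc x ∷ w))  ≡⟨ cong (normFrom (del (suc m) acc)) (del-there w x≢m) ⟩
  normFrom (del (suc m) acc ∷ʳ suc x) (del (suc m) w)   ≡⟨ cong (λ l → normFrom l (del (suc m) w)) acc≡ ⟨
  normFrom (del (suc m) (acc ∷ʳ suc x)) (del (suc m) w) ≡⟨ normFrom-del m (acc ∷ʳ suc x) w ⟩
  del (suc m) (normFrom (acc ∷ʳ suc x) w)               ∎
  where
  open ≡-Reasoning
  acc≡ : del (suc m) (acc ∷ʳ suc x) ≡ del (suc m) acc ∷ʳ suc x
  acc≡ = trans (filter-++ (≢? (suc m)) acc _) (cong (del (suc m) acc ++_) (del-there [] x≢m))

norm-del : ∀ m w → norm (del (suc m) w) ≡ del (suc m) (norm w)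
norm-del m = normFrom-del m []

del-norm-insAt : ∀ P {m w} → suc m ∉ w → del (suc m) (norm (insAt P (suc m) w)) ≡ norm w
del-norm-insAt P {m} {w} m∉w = trans (sym (norm-del m (insAt P (suc m) w))) (cong norm (del-insAt P m∉w))

map-insAt : ∀ (f : ℕ → ℕ) P m w → map f (insAt P m w) ≡ insAt P (f m) (map f w)
map-insAt f P m w = trans (map-++ f (take P w) (m ∷ drop P w))
  (cong₂ (λ xs ys → xs ++ f m ∷ ys) (sym (take-map P w)) (sym (drop-map P w)))

-- The new context is independent of `y`, so it serves both ends of a move.
insAt-around : ∀ P m as bs → ∃₂ λ as′ bs′ → ∀ y → insAt P m (as ++ y ∷ bs) ≡ as′ ++ y ∷ bs′
insAt-around zero    m as       bs = m ∷ as , bs , λ y → refl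
insAt-around (suc P) m []       bs = [] , insAt P m bs , λ y → refl
insAt-around (suc P) m (a ∷ as) bs =
  let as′ , bs′ , eq = insAt-around P m as bs in a ∷ as′ , bs′ , λ y → cong (a ∷_) (eq y)

up-≥ : ∀ {x v} → x ≤ v → up x v ≡ suc v
up-≥ z≤n       = refl
up-≥ (s≤s x≤v) = cong suc (up-≥ x≤v)

up-< : ∀ {x v} → v < x → up x v ≡ v
up-< z<s               = refl
up-< (s<s v<x@(s≤s _)) = cong suc (up-< v<x)

-- Labels for lengths above 5

abstract
  override : ℕ → Word → ℕ → ℕ
  override m v l with v ≟ʷ hub m
  ... | yes _ = 6 + m
  ... | no  _ = l

  override-hub : ∀ m {l} → override m (hub m) l ≡ 6 + m
  override-hub m with hub m ≟ʷ hub m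
  ... | yes _ = refl
  ... | no  n = contradiction refl n

  override-≢ : ∀ m {v l} → v ≢ hub m → override m v l ≡ l
  override-≢ m {v} v≢ with v ≟ʷ hub m
  ... | yes e = contradiction e v≢
  ... | no  _ = refl

  override-≤ : ∀ m v {l} → l ≤ 5 + m → override m v l ≤ 6 + m
  override-≤ m v l≤ with v ≟ʷ hub m
  ... | yes _ = ≤-refl
  ... | no  _ = m≤n⇒m≤1+n l≤

-- An inherited label is at most `5 + m`, so the maximum `5 + m` is written as the top letter
-- `6 + m`. Only the hub leaves the top letter out.
lab : ℕ → Word → ℕ
lab zero    v = label table₅ v
lab (suc m) v = override m v (lab m (del (5 + m) v))

lab-≤ : ∀ m v → lab m v ≤ 5 + m
lab-≤ zero    v = label-≤ table₅ (from-yes (all? (λ r → proj₁ (proj₂ r) ≤? 5) table₅)) v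
lab-≤ (suc m) v = override-≤ m v (lab-≤ m _)

lab-hub : ∀ m → lab (suc m) (hub m) ≡ 6 + m
lab-hub m = override-hub m

lab-del : ∀ m {v} → v ≢ hub m → lab (suc m) v ≡ lab m (del (5 + m) v)
lab-del m = override-≢ m

-- The induction hypothesis and the lifting of moves

module L m = Labelled (4 + m) (lab m)

Node : ℕ → Word → Set
Node m w = IsPerm (5 + m) w × norm w ≢ leaf m

record Link (m : ℕ) (v w : Word) : Set where
  constructor link
  field
    node₁ : Node m v
    node₂ : Node m w
    move  : L.Move m v w

link-sym : ∀ {m v w} → Link m v w → Link m w v
link-sym {m} {v} {w} (link a b mv) = link b a (L.move-sym m {v} {w} mv)

links-sym : ∀ {m v w} → Star (Link m) v w → Star (Link m) w v
links-sym {m} = Star.reverse (link-sym {m})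

-- Links avoid the leaf because the hub of the next length arises from it by inserting a maximum,
-- and there the label is not inherited. Links therefore lift at every place, while an exit lifts
-- whenever the word obtained is not the hub.
record Connected (m : ℕ) : Set where
  field
    connect : ∀ {v w} → Node m v → Node m w → Star (Link m) v w
    exit    : ∀ {w} → IsPerm (5 + m) w → norm w ≡ leaf m → ∃ λ d → Node m d × L.Move m w d

module Step (m : ℕ) where

  M : ℕ
  M = 5 + m

  ins : ℕ → Word → Word
  ins P = insAt P M

  desc-< : ∀ j {x} → x ∈ desc j → x < 5 + j
  desc-< (suc j) (here refl) = ≤-refl
  desc-< (suc j) (there x∈)  = m≤n⇒m≤1+n (desc-< j x∈)

  M∉desc : M ∉ desc m
  M∉desc M∈ = <-irrefl refl (desc-< m M∈)

  del-leaf : del M (leaf (suc m)) ≡ leaf m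
  del-leaf = cong (λ l → 0 ∷ 1 ∷ 2 ∷ 4 ∷ 3 ∷ l) (trans (del-here M (desc m)) (del-∉ M∉desc))

  del-hub : del M (hub m) ≡ leaf m
  del-hub = cong (0 ∷_) (trans (del-here M (1 ∷ 2 ∷ 4 ∷ 3 ∷ desc m)) (cong (λ l → 1 ∷ 2 ∷ 4 ∷ 3 ∷ l) (del-∉ M∉desc)))

  del-norm-ins : ∀ P {w} → IsPerm M w → del M (norm (ins P w)) ≡ norm w
  del-norm-ins P p = del-norm-insAt P (perm-n∉ p)

  -- Applied to the next leaf and to the hub, both of which become `leaf m` when the maximum is
  -- deleted.
  lift-≢ : ∀ P {w v} → Node m w → del M v ≡ leaf m → norm (ins P w) ≢ v
  lift-≢ P (p , w≢) v↦ eq = w≢ (trans (sym (del-norm-ins P p)) (trans (cong (del M) eq) v↦))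

  lift-node : ∀ P {w} → Node m w → Node (suc m) (ins P w)
  lift-node P nw = insAt-perm P (proj₁ nw) , lift-≢ P nw del-leaf

  lift-hub : ∀ P {w} → Node m w → norm (ins P w) ≢ hub m
  lift-hub P nw = lift-≢ P nw del-hub

  ℓ-ins : ∀ P {w} → IsPerm M w → norm (ins P w) ≢ hub m → L.ℓ (suc m) (ins P w) ≡ L.ℓ m w
  ℓ-ins P p ≢hub = trans (lab-del m ≢hub) (cong (lab m) (del-norm-ins P p))

  letters-ins : ∀ P {w} → IsPerm M w → norm (ins P w) ≢ hub m →
                L.letters (suc m) (ins P w) ≡ insAt P (suc M) (L.letters m w)
  letters-ins P {w} p ≢hub = begin
    map (up (L.ℓ (suc m) (ins P w))) (ins P w)  ≡⟨ cong (λ l → map (up l) (ins P w)) (ℓ-ins P p ≢hub) ⟩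
    map (up (L.ℓ m w)) (ins P w)                ≡⟨ map-insAt (up (L.ℓ m w)) P M w ⟩
    insAt P (up (L.ℓ m w) M) (L.letters m w)    ≡⟨ cong (λ y → insAt P y (L.letters m w)) (up-≥ (lab-≤ m (norm w))) ⟩
    insAt P (suc M) (L.letters m w)             ∎
    where open ≡-Reasoning

  lift-move : ∀ P {v w} → IsPerm M v → IsPerm M w → norm (ins P v) ≢ hub m → norm (ins P w) ≢ hub m →
              L.Move m v w → L.Move (suc m) (ins P v) (ins P w)
  lift-move P {v} {w} p q v≢ w≢ (as , bs , v≡ , w≡) =
    let as′ , bs′ , eq = insAt-around P (suc M) as bs in
    as′ , bs′ ,
    trans (letters-ins P p v≢) (trans (cong (insAt P (suc M)) v≡)
      (trans (eq (L.ℓ m w)) (cong (λ y → as′ ++ y ∷ bs′) (sym (ℓ-ins P q w≢))))) ,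
    trans (letters-ins P q w≢) (trans (cong (insAt P (suc M)) w≡)
      (trans (eq (L.ℓ m v)) (cong (λ y → as′ ++ y ∷ bs′) (sym (ℓ-ins P p v≢)))))

  lift-links : ∀ P {v w} → Star (Link m) v w → Star (Link (suc m)) (ins P v) (ins P w)
  lift-links P = Star.gmap (ins P) λ (link nv nw mv) →
    link (lift-node P nv) (lift-node P nw)
      (lift-move P (proj₁ nv) (proj₁ nw) (lift-hub P nv) (lift-hub P nw) mv)

-- The hub and its two neighbours

desc′ : ℕ → Word
desc′ zero    = []
desc′ (suc m) = 4 + m ∷ desc′ m

0∉desc : ∀ m → 0 ∉ desc m
0∉desc (suc m) (there 0∈) = 0∉desc m 0∈

0∉desc′ : ∀ m → 0 ∉ desc′ m
0∉desc′ (suc m) (there 0∈) = 0∉desc′ m 0∈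

desc-perm : ∀ m {w} → IsPerm 5 w → IsPerm (5 + m) (desc m ++ w)
desc-perm zero    p = p
desc-perm (suc m) p = prep (5 + m) (desc-perm m p)

desc′-perm : ∀ m {w} → IsPerm 4 w → IsPerm (4 + m) (desc′ m ++ w)
desc′-perm zero    p = p
desc′-perm (suc m) p = prep (4 + m) (desc′-perm m p)

leaf-perm : ∀ m → IsPerm (5 + m) (leaf m)
leaf-perm m = perm-++-comm (desc m) (desc-perm m (decide-perm 5 (0 ∷ 1 ∷ 2 ∷ 4 ∷ 3 ∷ [])))

hub-perm : ∀ m → IsPerm (6 + m) (hub m)
hub-perm m = insAt-perm 1 (leaf-perm m)

-- `bent m` is a neighbour of the hub without its maximum. Deleting further maxima ends at one of
-- two words of length 5, so the label can be read off the table.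
module Neighbour {x y l : ℕ} (perm₄ : IsPerm 4 (0 ∷ 1 ∷ x ∷ y ∷ []))
  (label₁ : label table₅ (0 ∷ 1 ∷ x ∷ y ∷ 4 ∷ []) ≡ l) (label₂ : label table₅ (0 ∷ 4 ∷ 1 ∷ x ∷ y ∷ []) ≡ l) where

  straight bent : ℕ → Word
  straight m = 0 ∷ 1 ∷ x ∷ y ∷ desc′ m
  bent m     = 0 ∷ 4 + m ∷ 1 ∷ x ∷ y ∷ desc′ m

  straight-perm : ∀ m → IsPerm (4 + m) (straight m)
  straight-perm m = perm-++-comm (desc′ m) (desc′-perm m perm₄)

  bent-perm : ∀ m → IsPerm (5 + m) (bent m)
  bent-perm m = insAt-perm 1 (straight-perm m)

  lab-straight : ∀ m → lab m (straight (suc m)) ≡ l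
  lab-straight zero    = label₁
  lab-straight (suc m) = trans (lab-del m λ ())
    (trans (cong (lab m) (del-insAt 4 (perm-n∉ (straight-perm (suc m))))) (lab-straight m))

  lab-bent : ∀ m → lab m (bent m) ≡ l
  lab-bent zero    = label₂
  lab-bent (suc m) = trans (lab-del m λ ())
    (trans (cong (lab m) (del-insAt 1 (perm-n∉ (straight-perm (suc m))))) (lab-straight m))

-- The common label has to be the letter of the hub that the move replaces: 2 here, 4 below.
module N₂ = Neighbour {3} {2} {2} (decide-perm 4 (0 ∷ 1 ∷ 3 ∷ 2 ∷ [])) refl refl
module N₄ = Neighbour {2} {3} {4} (decide-perm 4 (0 ∷ 1 ∷ 2 ∷ 3 ∷ [])) refl refl

module Hub (m : ℕ) where
  open Step m

  -- H is the hub rotated. Replacing its letter 2 or 4 by suc M, its missing letter, gives G₂ or G₄ after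
  -- passing to ranks, with the maximum M in adjacent places.
  c c₂ c₄ H G₂ G₄ : Word
  c  = 3 ∷ desc m  ++ 0 ∷ M ∷ 1 ∷ []
  c₂ = 2 ∷ desc′ m ++ 0 ∷ 4 + m ∷ 1 ∷ []
  c₄ = 3 ∷ desc′ m ++ 0 ∷ 4 + m ∷ 1 ∷ []
  H  = c  ++ 2 ∷ 4 ∷ []
  G₂ = c₂ ++ M ∷ 3 ∷ []
  G₄ = c₄ ++ 2 ∷ M ∷ []

  -- Every rank in `desc′ j` is at least 4, so a missing letter of at most 4 raises it by one.
  map-up-desc : ∀ j x → x ≤ 4 → map (up x) (desc′ j) ≡ desc j
  map-up-desc zero    x x≤4 = refl
  map-up-desc (suc j) x x≤4 = cong₂ _∷_ (up-≥ (≤-trans x≤4 (m≤m+n 4 j))) (map-up-desc j x x≤4)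

  up-c₂ : map (up 2) c₂ ≡ c
  up-c₂ = cong (3 ∷_) (trans (map-++ (up 2) (desc′ m) _) (cong (_++ 0 ∷ M ∷ 1 ∷ []) (map-up-desc m 2 (s≤s (s≤s z≤n)))))

  up-c₄ : map (up 4) c₄ ≡ c
  up-c₄ = cong (3 ∷_) (trans (map-++ (up 4) (desc′ m) _) (cong (_++ 0 ∷ M ∷ 1 ∷ []) (map-up-desc m 4 ≤-refl)))

  assoc₃ : ∀ x d (ys zs : Word) → (x ∷ d ++ ys) ++ zs ≡ (x ∷ d) ++ (ys ++ zs)
  assoc₃ x d ys zs = cong (x ∷_) (++-assoc d ys zs)

  norm-H : norm H ≡ hub m
  norm-H = trans (cong norm (assoc₃ 3 (desc m) (0 ∷ M ∷ 1 ∷ []) (2 ∷ 4 ∷ [])))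
    (norm-++ (3 ∷ desc m) _ λ { (there 0∈) → 0∉desc m 0∈ })

  norm-G₂ : norm G₂ ≡ ins 3 (N₂.bent m)
  norm-G₂ = trans (cong norm (assoc₃ 2 (desc′ m) (0 ∷ 4 + m ∷ 1 ∷ []) (M ∷ 3 ∷ [])))
    (norm-++ (2 ∷ desc′ m) _ λ { (there 0∈) → 0∉desc′ m 0∈ })

  norm-G₄ : norm G₄ ≡ ins 4 (N₄.bent m)
  norm-G₄ = trans (cong norm (assoc₃ 3 (desc′ m) (0 ∷ 4 + m ∷ 1 ∷ []) (2 ∷ M ∷ [])))
    (norm-++ (3 ∷ desc′ m) _ λ { (there 0∈) → 0∉desc′ m 0∈ })

  H-perm : IsPerm (suc M) H
  H-perm = subst (IsPerm (suc M)) (sym (assoc₃ 3 (desc m) (0 ∷ M ∷ 1 ∷ []) (2 ∷ 4 ∷ [])))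
    (perm-++-comm (0 ∷ M ∷ 1 ∷ 2 ∷ 4 ∷ []) (hub-perm m))

  G₂-perm : IsPerm (suc M) G₂
  G₂-perm = subst (IsPerm (suc M)) (sym (assoc₃ 2 (desc′ m) (0 ∷ 4 + m ∷ 1 ∷ []) (M ∷ 3 ∷ [])))
    (perm-++-comm (0 ∷ 4 + m ∷ 1 ∷ M ∷ 3 ∷ []) (insAt-perm 3 (N₂.bent-perm m)))

  G₄-perm : IsPerm (suc M) G₄
  G₄-perm = subst (IsPerm (suc M)) (sym (assoc₃ 3 (desc′ m) (0 ∷ 4 + m ∷ 1 ∷ []) (2 ∷ M ∷ [])))
    (perm-++-comm (0 ∷ 4 + m ∷ 1 ∷ 2 ∷ M ∷ []) (insAt-perm 4 (N₄.bent-perm m)))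

  ℓ-H : L.ℓ (suc m) H ≡ suc M
  ℓ-H = trans (cong (lab (suc m)) norm-H) (lab-hub m)

  ℓ-G₂ : L.ℓ (suc m) G₂ ≡ 2
  ℓ-G₂ = trans (cong (lab (suc m)) norm-G₂) (trans (lab-del m λ ())
    (trans (cong (lab m) (del-insAt 3 (perm-n∉ (N₂.bent-perm m)))) (N₂.lab-bent m)))

  ℓ-G₄ : L.ℓ (suc m) G₄ ≡ 4
  ℓ-G₄ = trans (cong (lab (suc m)) norm-G₄) (trans (lab-del m λ ())
    (trans (cong (lab m) (del-insAt 4 (perm-n∉ (N₄.bent-perm m)))) (N₄.lab-bent m)))

  -- The missing letter `suc M` exceeds all ranks, so letters and ranks agree.
  letters-H : L.letters (suc m) H ≡ H
  letters-H = trans (cong (λ l → map (up l) H) ℓ-H)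
    (map-id-local (All.tabulate λ x∈ → up-< (perm-< H-perm x∈)))

  move₂ : L.Move (suc m) H G₂
  move₂ = c , 4 ∷ [] ,
    trans letters-H (cong (λ l → c ++ l ∷ 4 ∷ []) (sym ℓ-G₂)) ,
    (begin
      L.letters (suc m) G₂           ≡⟨ cong (λ l → map (up l) G₂) ℓ-G₂ ⟩
      map (up 2) G₂                  ≡⟨ map-++ (up 2) c₂ (M ∷ 3 ∷ []) ⟩
      map (up 2) c₂ ++ suc M ∷ 4 ∷ [] ≡⟨ cong₂ (λ xs l → xs ++ l ∷ 4 ∷ []) up-c₂ (sym ℓ-H) ⟩
      c ++ L.ℓ (suc m) H ∷ 4 ∷ []    ∎)
    where open ≡-Reasoning

  move₄ : L.Move (suc m) H G₄
  move₄ = c ∷ʳ 2 , [] ,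
    trans letters-H (trans (sym (++-assoc c [ 2 ] [ 4 ])) (cong (λ l → (c ∷ʳ 2) ++ l ∷ []) (sym ℓ-G₄))) ,
    (begin
      L.letters (suc m) G₄            ≡⟨ cong (λ l → map (up l) G₄) ℓ-G₄ ⟩
      map (up 4) G₄                   ≡⟨ map-++ (up 4) c₄ (2 ∷ M ∷ []) ⟩
      map (up 4) c₄ ++ 2 ∷ suc M ∷ [] ≡⟨ cong₂ (λ xs l → xs ++ 2 ∷ l ∷ []) up-c₄ (sym ℓ-H) ⟩
      c ++ 2 ∷ L.ℓ (suc m) H ∷ []     ≡⟨ ++-assoc c [ 2 ] (L.ℓ (suc m) H ∷ []) ⟨
      (c ∷ʳ 2) ++ L.ℓ (suc m) H ∷ []  ∎)
    where open ≡-Reasoning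

  -- Equivalently, w arises from some Node m by inserting M; this form is invariant under rotation.
  Lifted : Word → Set
  Lifted w = IsPerm (suc M) w × del M (norm w) ≢ leaf m

  lifted-node : ∀ {w} → Lifted w → Node (suc m) w
  lifted-node (p , ≢leaf) = p , λ eq → ≢leaf (trans (cong (del M) eq) del-leaf)

  lifted-⟲ : ∀ {v w} → v ⟲ w → Lifted v → Lifted w
  lifted-⟲ r (p , ≢leaf) = ⟲-perm r p , ≢leaf ∘ trans (cong (del M) (⟲-norm r p))

  lifted-ins : ∀ P {w} → IsPerm M w → Lifted (ins P w) → Node m w
  lifted-ins P p (_ , ≢leaf) = p , ≢leaf ∘ trans (del-norm-ins P p)

  lifted-mid : ∀ xs ys → Lifted (xs ++ M ∷ ys) → Node m (xs ++ ys)
  lifted-mid xs ys l@(p , _) = lifted-ins (length xs) (delete-max xs p) (subst Lifted (sym (insAt-++ xs M ys)) l)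

  G₂-lifted : Lifted G₂
  G₂-lifted = G₂-perm , λ eq →
    case trans (sym (trans (cong (del M) norm-G₂) (del-insAt 3 (perm-n∉ (N₂.bent-perm m))))) eq of λ ()

  G₄-lifted : Lifted G₄
  G₄-lifted = G₄-perm , λ eq →
    case trans (sym (trans (cong (del M) norm-G₄) (del-insAt 4 (perm-n∉ (N₄.bent-perm m))))) eq of λ ()

  hub-node : ∀ {w} → IsPerm (suc M) w → norm w ≡ hub m → Node (suc m) w
  hub-node p eq = p , λ eq′ → case trans (sym eq) eq′ of λ ()

  hub-exit : ∀ {w} → IsPerm (suc M) w → norm w ≡ hub m → ∃ λ g → Lifted g × Link (suc m) w g
  hub-exit {w} p eq =
    let g , r , mv = L.move-⟲ (suc m) H-perm G₂-perm move₂ (norm-⟲ H-perm p (trans norm-H (sym eq)))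
        lg = lifted-⟲ r G₂-lifted
    in g , lg , link (hub-node p eq) (lifted-node lg) mv

  -- The maximum passes to the adjacent place. The words around it may change, since the induction
  -- hypothesis connects all nodes at a fixed place.
  Shift : ℕ → Set
  Shift P = ∃₂ λ v w → Node m v × Node m w × Star (Link (suc m)) (ins P v) (ins (suc P) w)

  -- Cut `c`, `c₂` and `c₄` at the same place and rotate the three words alike. The maximum then
  -- stands behind `ys₂` in one neighbour and behind `ys₄` and the letter 2 in the other; the
  -- rotated hub is linked to both.
  shift-at : ∀ xs ys xs₂ ys₂ xs₄ ys₄ → c ≡ xs ++ ys → c₂ ≡ xs₂ ++ ys₂ → c₄ ≡ xs₄ ++ ys₄ →
             length xs ≡ length xs₂ → length xs ≡ length xs₄ → length ys₂ ≡ length ys₄ → Shift (length ys₂)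
  shift-at xs ys xs₂ ys₂ xs₄ ys₄ c≡ c₂≡ c₄≡ |xs₂| |xs₄| |ys| =
    ys₂ ++ 3 ∷ xs₂ , (ys₄ ++ 2 ∷ []) ++ xs₄ , lifted-mid ys₂ (3 ∷ xs₂) G₂-l ,
    lifted-mid (ys₄ ++ 2 ∷ []) xs₄ (subst Lifted (sym (++-assoc ys₄ [ 2 ] (M ∷ xs₄))) G₄-l) ,
    subst₂ (Star (Link (suc m))) (sym (insAt-++ ys₂ M (3 ∷ xs₂))) G₄-eq
      (link-sym {suc m} (link H-node (lifted-node G₂-l) mv₂) ◅ link H-node (lifted-node G₄-l) mv₄ ◅ ε)
    where
    turned : ∀ {d e} as bs → d ≡ as ++ bs → d ++ e ≡ as ++ (bs ++ e)
    turned {e = e} as bs eq = trans (cong (_++ e) eq) (++-assoc as bs e)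
    r₂ : G₂ ⟲ ys₂ ++ M ∷ 3 ∷ xs₂
    r₂ = subst₂ _⟲_ (sym (turned xs₂ ys₂ c₂≡)) (++-assoc ys₂ (M ∷ 3 ∷ []) xs₂) (⟲-++ xs₂ (ys₂ ++ M ∷ 3 ∷ []))
    r₄ : G₄ ⟲ ys₄ ++ 2 ∷ M ∷ xs₄
    r₄ = subst₂ _⟲_ (sym (turned xs₄ ys₄ c₄≡)) (++-assoc ys₄ (2 ∷ M ∷ []) xs₄) (⟲-++ xs₄ (ys₄ ++ 2 ∷ M ∷ []))
    r : H ⟲ (ys ++ 2 ∷ 4 ∷ []) ++ xs
    r = subst (_⟲ (ys ++ 2 ∷ 4 ∷ []) ++ xs) (sym (turned xs ys c≡)) (⟲-++ xs (ys ++ 2 ∷ 4 ∷ []))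
    G₂-l : Lifted (ys₂ ++ M ∷ 3 ∷ xs₂)
    G₂-l = lifted-⟲ r₂ G₂-lifted
    G₄-l : Lifted (ys₄ ++ 2 ∷ M ∷ xs₄)
    G₄-l = lifted-⟲ r₄ G₄-lifted
    H-node : Node (suc m) ((ys ++ 2 ∷ 4 ∷ []) ++ xs)
    H-node = hub-node (⟲-perm r H-perm) (trans (sym (⟲-norm r H-perm)) norm-H)
    mv₂ : L.Move (suc m) ((ys ++ 2 ∷ 4 ∷ []) ++ xs) (ys₂ ++ M ∷ 3 ∷ xs₂)
    mv₂ = subst (L.Move (suc m) _) (++-assoc ys₂ (M ∷ 3 ∷ []) xs₂)
      (L.move-++ (suc m) {xs} {ys ++ 2 ∷ 4 ∷ []} {xs₂} {ys₂ ++ M ∷ 3 ∷ []} |xs₂|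
        (subst (IsPerm _) (turned xs ys c≡) H-perm) (subst (IsPerm _) (turned xs₂ ys₂ c₂≡) G₂-perm)
        (subst₂ (L.Move (suc m)) (turned xs ys c≡) (turned xs₂ ys₂ c₂≡) move₂))
    mv₄ : L.Move (suc m) ((ys ++ 2 ∷ 4 ∷ []) ++ xs) (ys₄ ++ 2 ∷ M ∷ xs₄)
    mv₄ = subst (L.Move (suc m) _) (++-assoc ys₄ (2 ∷ M ∷ []) xs₄)
      (L.move-++ (suc m) {xs} {ys ++ 2 ∷ 4 ∷ []} {xs₄} {ys₄ ++ 2 ∷ M ∷ []} |xs₄|
        (subst (IsPerm _) (turned xs ys c≡) H-perm) (subst (IsPerm _) (turned xs₄ ys₄ c₄≡) G₄-perm)
        (subst₂ (L.Move (suc m)) (turned xs ys c≡) (turned xs₄ ys₄ c₄≡) move₄))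
    G₄-eq : ys₄ ++ 2 ∷ M ∷ xs₄ ≡ ins (suc (length ys₂)) ((ys₄ ++ 2 ∷ []) ++ xs₄)
    G₄-eq = sym (trans
      (cong (λ P → ins P ((ys₄ ++ 2 ∷ []) ++ xs₄))
        (trans (cong suc |ys|) (trans (+-comm 1 (length ys₄)) (sym (length-++ ys₄)))))
      (trans (insAt-++ (ys₄ ++ 2 ∷ []) M xs₄) (++-assoc ys₄ [ 2 ] (M ∷ xs₄))))

  c₂-length : length c₂ ≡ 4 + m
  c₂-length = cong suc (trans (length-++ (desc′ m)) (trans (cong (_+ 3) (desc′-length m)) (+-comm m 3)))
    where
    desc′-length : ∀ j → length (desc′ j) ≡ j
    desc′-length zero    = refl
    desc′-length (suc j) = cong suc (desc′-length j)

  shift-from : ∀ P → P ≤ 4 + m → Shift P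
  shift-from P P≤ = subst Shift |drop| (shift-at (take j c) (drop j c) (take j c₂) (drop j c₂) (take j c₄) (drop j c₄)
    (sym (take++drop≡id j c)) (sym (take++drop≡id j c₂)) (sym (take++drop≡id j c₄))
    (same-take (trans (sym (length-map (up 2) c₂)) (cong length up-c₂)))
    (same-take (trans (sym (length-map (up 4) c₄)) (cong length up-c₄)))
    (trans (length-drop j c₂) (sym (length-drop j c₄))))
    where
    -- As `c₂` has length `4 + m`, exactly `P` letters are left in front of the maximum.
    j = 4 + m ∸ P
    same-take : ∀ {xs} → length xs ≡ length c → length (take j c) ≡ length (take j xs)
    same-take {xs} eq = trans (length-take j c) (trans (cong (j ⊓_) (sym eq)) (sym (length-take j xs)))
    |drop| : length (drop j c₂) ≡ P
    |drop| = trans (length-drop j c₂) (trans (cong (_∸ j) c₂-length) (m∸[m∸n]≡n P≤))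

-- The induction step

module _ {m : ℕ} (conn : Connected m) where
  open Step m
  open Hub m
  open Connected conn

  -- Any node would serve as the goal; this one comes with a shift.
  root : Word
  root = let v , _ = shift-from 0 z≤n in v

  root-node : Node m root
  root-node = let _ , _ , nv , _ = shift-from 0 z≤n in nv

  -- At each place the induction hypothesis leads to the word from which a shift, taken backwards,
  -- brings the maximum one place nearer to the front.
  ins⇝root : ∀ P → P ≤ M → ∀ {v} → Node m v → Star (Link (suc m)) (ins P v) (ins 0 root)
  ins⇝root zero    _         nv = lift-links 0 (connect nv root-node)
  ins⇝root (suc P) (s≤s P≤) nv =
    let _ , _ , nv₁ , nv₂ , shift = shift-from P P≤ in
    lift-links (suc P) (connect nv nv₂) ◅◅ links-sym {suc m} shift ◅◅ ins⇝root P (m≤n⇒m≤1+n P≤) nv₁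

  lifted⇝root : ∀ {w} → Lifted w → Star (Link (suc m)) w (ins 0 root)
  lifted⇝root l =
    let P , v , pv , P≤ , eq = split-max (proj₁ l) in
    subst (λ w → Star (Link (suc m)) w (ins 0 root)) (sym eq) (ins⇝root P P≤ (lifted-ins P pv (subst Lifted eq l)))

  lift-exit : ∀ P {v} → IsPerm M v → norm v ≡ leaf m → norm (ins P v) ≢ hub m →
              ∃ λ d → Node m d × L.Move (suc m) (ins P v) (ins P d)
  lift-exit P pv eq ≢hub =
    let d , nd , mv = exit pv eq in d , nd , lift-move P pv (proj₁ nd) ≢hub (lift-hub P nd) mv

  -- A maximum inserted into a leaf word gives either the hub, which has its own neighbours, or a
  -- word to which the exit of the leaf lifts.
  ins-node⇝root : ∀ P → P ≤ M → ∀ {v} → IsPerm M v → Node (suc m) (ins P v) →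
                  Dec (norm v ≡ leaf m) → Dec (norm (ins P v) ≡ hub m) → Star (Link (suc m)) (ins P v) (ins 0 root)
  ins-node⇝root P P≤ pv nw (no v≢leaf) _        = ins⇝root P P≤ (pv , v≢leaf)
  ins-node⇝root P P≤ pv nw (yes _)  (yes e)  = let _ , lg , l = hub-exit (proj₁ nw) e in l ◅ lifted⇝root lg
  ins-node⇝root P P≤ pv nw (yes e)  (no ≢h) =
    let d , nd , mv = lift-exit P pv e ≢h in link nw (lift-node P nd) mv ◅ ins⇝root P P≤ nd

  node⇝root : ∀ {w} → Node (suc m) w → Star (Link (suc m)) w (ins 0 root)
  node⇝root nw =
    let P , v , pv , P≤ , eq = split-max (proj₁ nw) in
    subst (λ w → Star (Link (suc m)) w (ins 0 root)) (sym eq)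
      (ins-node⇝root P P≤ pv (subst (Node (suc m)) eq nw) (norm v ≟ʷ leaf m) (norm (ins P v) ≟ʷ hub m))

  connected-suc : Connected (suc m)
  connected-suc = record
    { connect = λ nv nw → node⇝root nv ◅◅ links-sym {suc m} (node⇝root nw)
    ; exit    = exit′
    }
    where
    exit′ : ∀ {w} → IsPerm (suc M) w → norm w ≡ leaf (suc m) → ∃ λ d → Node (suc m) d × L.Move (suc m) w d
    exit′ {w} p eq =
      -- The new leaf comes from the old one and is not the hub, so the old exit lifts.
      let P , v , pv , _ , w≡ = split-max p
          eqᵥ = trans (cong norm (sym w≡)) eq
          d , nd , mv = lift-exit P pv (trans (sym (del-norm-ins P pv)) (trans (cong (del M) eqᵥ) del-leaf))
                          (λ eq′ → case trans (sym eqᵥ) eq′ of λ ())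
      in ins P d , lift-node P nd , subst (λ u → L.Move (suc m) u (ins P d)) (sym w≡) mv

-- Start of the induction

follow-star : ∀ {R : Word → Word → Set} {P : Word → Set} {nx r} →
              (∀ {w} → P w → Star R w (nx w) × P (nx w)) → ∀ j {w} → P w → Star R w (follow nx r j w)
follow-star         step zero        pw = ε
follow-star {r = r} step (suc j) {w} pw with w ≟ʷ r
... | yes _ = ε
... | no  _ = let s , pn = step pw in s ◅◅ follow-star step j pn

connected₀ : Connected 0
connected₀ = record
  { connect = λ nv nw → to-root nv ◅◅ links-sym {0} (to-root nw)
  ; exit    = λ {w} p eq → C₅.next w , next-node p , C₅.valid⇒move {w} (proj₁ (proj₁ (check p)))
  }
  where
  check : ∀ {w} → IsPerm 5 w → Checked₅ w
  check p = All.lookup checked₅ (perms-complete p)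
  next-node : ∀ {w} → IsPerm 5 w → Node 0 (C₅.next w)
  next-node p = perms-sound (proj₁ (proj₁ (proj₁ (check p)))) , proj₂ (proj₁ (check p))
  to-root : ∀ {w} → Node 0 w → Star (Link 0) w root₅
  to-root {w} nw = subst (Star (Link 0) w) (proj₂ (check (proj₁ nw)) (proj₂ nw))
    (follow-star (λ {v} nv → (link nv (next-node (proj₁ nv)) (C₅.valid⇒move {v} (proj₁ (proj₁ (check (proj₁ nv))))) ◅ ε)
      , next-node (proj₁ nv)) 31 nw)

connected : ∀ m → Connected m
connected zero    = connected₀
connected (suc m) = connected-suc (connected m)

-- Conclusion for lengths 3, 4 and at least 5

module _ (k : ℕ) (f : Word → ℕ) where
  open Labelled k f

  edge-connected⇒universal : ∀ {x xs} → IsPerm (suc k) (x ∷ xs) →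
    (∀ {w} → IsPerm (suc k) w → Star Edge (x ∷ xs) w) → UniversalCycleExists (suc k)
  edge-connected⇒universal p conn = let _ , c , L↭ = hamiltonian p conn in universal c L↭

module Small (k : ℕ) (t : Table) (j : ℕ) (x : ℕ) (xs : Word) where
  open Check k t

  -- In contrast to length 5, rotations are allowed between moves, so the walk runs through normal
  -- forms.
  nx : Word → Word
  nx = norm ∘ next

  Checked : Word → Set
  Checked w = Valid w × follow nx (x ∷ xs) j w ≡ x ∷ xs

  checked? : ∀ w → Dec (Checked w)
  checked? w = valid? w ×-dec (follow nx (x ∷ xs) j w ≟ʷ (x ∷ xs))

  small : IsPerm (suc k) (x ∷ xs) → All Checked (perms (suc k)) → UniversalCycleExists (suc k)
  small p checks = edge-connected⇒universal k (label t) p λ q → edges-sym q (to-root q)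
    where
    check : ∀ {w} → IsPerm (suc k) w → Checked w
    check q = All.lookup checks (perms-complete q)
    step : ∀ {w} → IsPerm (suc k) w → Star Edge w (nx w) × IsPerm (suc k) (nx w)
    step {w} q =
      let v = proj₁ (check q)
          nq = perms-sound (proj₁ v)
          r = norm-⟲-self nq
      in move-edges q nq (valid⇒move {w} v) ◅◅ ⟲-edges r , ⟲-perm r nq
    to-root : ∀ {w} → IsPerm (suc k) w → Star Edge w (x ∷ xs)
    to-root {w} q = subst (Star Edge w) (proj₂ (check q)) (follow-star step j q)

table₃ table₄ : Table
table₃ =
  (0 ∷ 1 ∷ 2 ∷ [] , 0 , 2) ∷
  (0 ∷ 2 ∷ 1 ∷ [] , 2 , 0) ∷
  []
table₄ =
  (0 ∷ 1 ∷ 2 ∷ 3 ∷ [] , 0 , 2) ∷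
  (0 ∷ 1 ∷ 3 ∷ 2 ∷ [] , 4 , 1) ∷
  (0 ∷ 2 ∷ 1 ∷ 3 ∷ [] , 0 , 4) ∷
  (0 ∷ 2 ∷ 3 ∷ 1 ∷ [] , 2 , 0) ∷
  (0 ∷ 3 ∷ 1 ∷ 2 ∷ [] , 3 , 0) ∷
  (0 ∷ 3 ∷ 2 ∷ 1 ∷ [] , 1 , 3) ∷
  []

-- The numbers 5 and 8 bound the walks to the increasing word.
module S₃ = Small 2 table₃ 5 0 (1 ∷ 2 ∷ [])
module S₄ = Small 3 table₄ 8 0 (1 ∷ 2 ∷ 3 ∷ [])

universal₃ : UniversalCycleExists 3
universal₃ = S₃.small (decide-perm 3 _) (from-yes (all? S₃.checked? (perms 3)))

universal₄ : UniversalCycleExists 4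
universal₄ = S₄.small (decide-perm 4 _) (from-yes (all? S₄.checked? (perms 4)))

module _ (m : ℕ) where
  open Labelled (4 + m) (lab m)
  open Connected (connected m)

  links⇒edges : ∀ {v w} → Star (Link m) v w → Star Edge v w
  links⇒edges = Star.kleisliStar id λ (link nv nw mv) → move-edges (proj₁ nv) (proj₁ nw) mv

  universal₅₊ : UniversalCycleExists (5 + m)
  universal₅₊ = edge-connected⇒universal (4 + m) (lab m) (leaf-perm m)
    λ {w} p → edges-sym p (reach p (norm w ≟ʷ leaf m))
    where
    to-leaf : ∀ {d} → Node m d → Star Edge d (leaf m)
    to-leaf nd =
      -- The leaf is entered by reversing its exit.
      let d′ , nd′ , mv = exit (leaf-perm m) (cong (0 ∷_) (++-identityʳ _))
      in links⇒edges (connect nd nd′) ◅◅ move-edges (proj₁ nd′) (leaf-perm m) (move-sym {leaf m} {d′} mv)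
    reach : ∀ {w} → IsPerm (5 + m) w → Dec (norm w ≡ leaf m) → Star Edge w (leaf m)
    reach p (no ≢leaf) = to-leaf (p , ≢leaf)
    reach p (yes e) = let _ , nd , mv = exit p e in move-edges p (proj₁ nd) mv ◅◅ to-leaf nd

theorem1 : ∀ (n : ℕ) → 3 ≤ n →
    ∃ λ (u : Vector ℕ (n !)) →
    (∀ k → u k ≤ n) ×
    (∀ (a : Vector ℕ n) → IsPermutation a →
    ∃! _≡_ λ i → OrderIsomorphic a (cyclicInterval u n i))
theorem1 1 (s≤s ())
theorem1 2 (s≤s (s≤s ()))
theorem1 3 _ = universal₃
theorem1 4 _ = universal₄
theorem1 (suc (suc (suc (suc (suc m))))) _ = universal₅₊ m
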